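{- Let $B$ be a commutative Bézout domain with good factorization and let $M_V$ be a model of $T_{B,V,div}$, i.e. a $B$-module $M$ expanded by the predicates $V_\delta(M)=Ma$ for $\delta=v(a)\in\Gamma(B)^+$, $a\in B\setminus\{0\}$. Let $\phi(\mathbf y)$ be a positive primitive (pp) $\mathcal L_{B,V}$-formula. Then there are a finite set $I$, a finite partition of $MSpec(B)$ into subsets $O_i$ ($i\in I$), each of which is a basic open or a basic closed subset, and for each $i\in I$ a conjunction $\theta_i(\mathbf y)$ of atomic $\mathcal L_{B_{\mathcal M},V}$-formulas (for $\mathcal M\in O_i$) such that for every tuple $\mathbf u$ of elements of $M$, $$M_V\models\phi(\mathbf u)\iff \bigwedge_{i\in I}\Big(\text{for all }\mathcal M\in O_i,\ (M_{\mathcal M})_V\models\theta_i(\mathbf u_{\mathcal M})\Big),$$ where $\mathbf u_{\mathcal M}$ denotes the image of the tuple $\mathbf u$ in the localization $M_{\mathcal M}$.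
   Context: Rings are commutative integral domains with $1$; $B$ is Bézout if every finitely generated ideal is principal. For $d\in B$, $rad(d)$ is the intersection of all maximal ideals of $B$ containing $d$. $B$ has good factorization if for all nonzero $a,b\in B$ there are $c,d\in B$ with $a=cd$, $\gcd(c,b)=1$ and $b\in rad(d)$. $Q(B)$ is the fraction field, $U$ the group of units of $B$, and $\Gamma(B)=Q(B)^\times/U$ the group of divisibility, (lattice-)ordered by $aU\le bU$ iff $ba^{ -1}\in B$; its positive part is $\Gamma(B)^+=\{aU: a\in B\setminus\{0\}\}$, and $v(a)=aU$. $MSpec(B)$ is the set of maximal ideals of $B$; the basic closed sets are $V(a)=\{\mathcal M\in MSpec(B): a\in\mathcal M\}$, $a\in B$, and the basic open sets are their complements. For $\mathcal M\in MSpec(B)$, $B_{\mathcal M}$ is the localization (a valuation domain), $\Gamma(B_{\mathcal M})$ is its value group, $v_{\mathcal M}$ its valuation, and $\delta_{\mathcal M}$ is the image in $\Gamma(B_{\mathcal M})$ of $\delta\in\Gamma(B)$. $M_{\mathcal M}=M\otimes_B B_{\mathcal M}$ is the localization of $M$. For a Bézout domain $R$, $\mathcal L_R=\{+,-,0,\cdot a: a\in R\}$ is the language of $R$-modules and $\mathcal L_{R,V}=\mathcal L_R\cup\{V_\delta:\delta\in\Gamma(R)^+\}$ with unary predicates $V_\delta$. The theory $T_{R,V,div}$ consists of the theory of $R$-modules together with: (1) $V_\delta(0)$; (2) $V_{\delta_1}(m_1)\wedge V_{\delta_2}(m_2)\to V_{\delta_1\wedge\delta_2}(m_1+m_2)$;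 (3) $V_\delta(m)\to V_{\delta\wedge\mu}(m)$; (4) $V_\delta(m)\to V_{\delta\cdot v(a)}(ma)$ for $a\in R\setminus\{0\}$; (5) $\forall m\,V_1(m)$; (6) $V_{v(a)}(m)\to\exists n\,(na=m)$ for $a\in R\setminus\{0\}$ (for all $\delta,\delta_i,\mu\in\Gamma(R)^+$). Equivalently, a model is an $R$-module $N$ with $V_{v(a)}(N)=Na$ for every $a\in R\setminus\{0\}$. In $(M_{\mathcal M})_V$ the predicates are interpreted in this way for the $B_{\mathcal M}$-module $M_{\mathcal M}$: $V_\delta(M_{\mathcal M})=M_{\mathcal M}a$ whenever $\delta=v_{\mathcal M}(a)$. A pp formula is one of the form $\exists\mathbf x\,\theta(\mathbf x,\mathbf y)$ with $\theta$ a conjunction of atomic formulas. That $\theta_i$ is a single conjunction of atomic $\mathcal L_{B_{\mathcal M},V}$-formulas over $O_i$ means: its scalars are elements of $Q(B)$ that lie in $B_{\mathcal M}$ for every $\mathcal M\in O_i$, and its predicates are $V_\delta$ with $\delta\in\Gamma(B)$ such that $\delta_{\mathcal M}\in\Gamma(B_{\mathcal M})^+$ for every $\mathcal M\in O_i$, $V_\delta$ being read as $V_{\delta_{\mathcal M}}$ in $B_{\mathcal M}$-modules. -}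

module Defs where

open import Algebra.Bundles using (AbelianGroup; CommutativeRing; Semiring)
open import Algebra.Module.Bundles using (Module)
open import Algebra.Module.Structures.Biased using (IsModuleFromLeft)
import Algebra.Definitions.RawSemiring as RawSemiringDefs
import Algebra.Module.Construct.TensorUnit as TensorUnit
import Algebra.Properties.Group as GroupProperties
import Algebra.Solver.Ring.NaturalCoefficients.Default as CommutativeSemiringSolver
open import Data.Fin.Base using (Fin)
open import Data.List.Base using (List)
open import Data.List.Relation.Unary.All using (All)
open import Data.Nat.Base as ℕ using (ℕ)
open import Data.Product.Base using (∃; ∃₂; _×_; _,_; proj₁; proj₂)
open import Data.Product using (∃!)
open import Data.Sum.Base using (_⊎_; inj₁; inj₂; [_,_]′)
import Data.Sum.Base as Sum
open import Data.Vec.Functional using (Vector; _++_; map)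
open import Level using (Level; Lift; _⊔_; suc)
open import Relation.Binary.Bundles using (Poset)
open import Relation.Binary.PropositionalEquality.Core using (_≡_)
import Relation.Binary.Reasoning.Setoid as SetoidReasoning
open import Relation.Nullary.Negation.Core using (¬_; contradiction)
open import Relation.Unary using (Pred; _∈_; _∉_; _⊆_; _≐_; ∁; Satisfiable)

private
  variable
    a c ℓ m ℓm ℓv p s d : Level

------------------------------------------------------------------------
-- Zorn's lemma

-- To be assumed where maximal ideals have to exist.  The empty chain is
-- included in the hypothesis, which forces the poset to be inhabited.

ZornsLemma : ∀ a ℓ₁ ℓ₂ p → Set (suc (a ⊔ ℓ₁ ⊔ ℓ₂ ⊔ p))
ZornsLemma a ℓ₁ ℓ₂ p = (P : Poset a ℓ₁ ℓ₂) → let open Poset P in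
  ((C : Pred Carrier p) →
    (∀ {x y} → x ∈ C → y ∈ C → x ≤ y ⊎ y ≤ x) →
    ∃ λ u → ∀ {x} → x ∈ C → x ≤ u) →
  ∃ λ z → ∀ {x} → z ≤ x → x ≈ z

------------------------------------------------------------------------
-- Ideals

module _ (R : CommutativeRing c ℓ) where
  open CommutativeRing R
  open RawSemiringDefs (Semiring.rawSemiring semiring) using (_∣_; sum; Coprime)

  -- Under excluded middle the level of the membership predicate is
  -- immaterial.  This one accommodates finitely generated ideals.

  record Ideal : Set (suc (c ⊔ ℓ)) where
    field
      member   : Pred Carrier (c ⊔ ℓ)
      respects : ∀ {x y} → x ≈ y → x ∈ member → y ∈ member
      0∈       : 0# ∈ member
      +-closed : ∀ {x y} → x ∈ member → y ∈ member → x + y ∈ member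
      *-closed : ∀ r {x} → x ∈ member → r * x ∈ member

  open Ideal

  IsProper : Pred Ideal (c ⊔ ℓ)
  IsProper I = 1# ∉ member I

  IsMaximal : Pred Ideal (suc (c ⊔ ℓ))
  IsMaximal I = IsProper I ×
    (∀ J → member I ⊆ member J → IsProper J → member J ⊆ member I)

  record MSpec : Set (suc (c ⊔ ℓ)) where
    field
      ideal     : Ideal
      isMaximal : IsMaximal ideal
    open Ideal ideal public

  rad : Carrier → Pred Carrier (suc (c ⊔ ℓ))
  rad d x = ∀ (𝓜 : MSpec) → d ∈ MSpec.member 𝓜 → x ∈ MSpec.member 𝓜

  Generated : ∀ {n} → Vector Carrier n → Pred Carrier (c ⊔ ℓ)
  Generated {n} g x = ∃ λ (r : Vector Carrier n) → x ≈ sum (λ i → r i * g i)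

  IsBézout : Set (c ⊔ ℓ)
  IsBézout = ∀ {n} (g : Vector Carrier n) → ∃ λ d → Generated g ≐ (d ∣_)

  HasGoodFactorization : Set (suc (c ⊔ ℓ))
  HasGoodFactorization = ∀ {a b} → ¬ a ≈ 0# → ¬ b ≈ 0# →
    ∃₂ λ c d → a ≈ c * d × Coprime c b × b ∈ rad d

  basicClosed : Carrier → Pred MSpec (c ⊔ ℓ)
  basicClosed a 𝓜 = a ∈ MSpec.member 𝓜

  IsBasicClosed IsBasicOpen : Pred (Pred MSpec (c ⊔ ℓ)) (suc (c ⊔ ℓ))
  IsBasicClosed O = ∃ λ a → O ≐ basicClosed a
  IsBasicOpen   O = ∃ λ a → O ≐ ∁ (basicClosed a)

IsPartition : {A : Set a} {k : ℕ} → (Fin k → Pred A p) → Set (a ⊔ p)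
IsPartition O = (∀ i → Satisfiable (O i)) × (∀ x → ∃! _≡_ λ i → x ∈ O i)

------------------------------------------------------------------------
-- Localization of rings and modules

record MultiplicativeSet (R : CommutativeRing c ℓ) p : Set (c ⊔ suc p) where
  open CommutativeRing R using (Carrier; _*_; 1#)
  field
    member   : Pred Carrier p
    1∈       : 1# ∈ member
    *-closed : ∀ {x y} → x ∈ member → y ∈ member → x * y ∈ member

module Localization (R : CommutativeRing c ℓ) (S : MultiplicativeSet R p) where
  open CommutativeRing R hiding (zero; -_)
  open MultiplicativeSet S renaming (member to S∋; *-closed to _∙∈_)

  open CommutativeSemiringSolver commutativeSemiring using (solve; _:=_; _:*_; _:+_)

  record Fraction (A : Set a) : Set (a ⊔ c ⊔ p) where
    constructor _/_[_]
    field
      num   : A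
      den   : Carrier
      den∈S : den ∈ S∋

  open Fraction public

  embed : {A : Set a} → A → Fraction A
  embed x = x / 1# [ 1∈ ]

  -- The module of fractions M_S, canonically isomorphic to M ⊗ R_S.
  module Additive (M : Module R m ℓm) where
    open Module M

    infix 4 _≋_
    infixl 6 _⊞_
    infix 8 ⊟_

    record _≋_ (f g : Fraction Carrierᴹ) : Set (c ⊔ p ⊔ ℓm) where
      constructor equal
      field
        factor   : Carrier
        factor∈S : factor ∈ S∋
        equality : factor *ₗ (den g *ₗ num f) ≈ᴹ factor *ₗ (den f *ₗ num g)

    _⊞_ : Fraction Carrierᴹ → Fraction Carrierᴹ → Fraction Carrierᴹ
    (x / s [ s∈ ]) ⊞ (y / t [ t∈ ]) = (t *ₗ x +ᴹ s *ₗ y) / s * t [ s∈ ∙∈ t∈ ]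

    ⊟_ : Fraction Carrierᴹ → Fraction Carrierᴹ
    ⊟ (x / s [ s∈ ]) = (-ᴹ x) / s [ s∈ ]

    𝟘 : Fraction Carrierᴹ
    𝟘 = embed 0ᴹ

    open SetoidReasoning ≈ᴹ-setoid

    cross : ∀ {f g} → den g *ₗ num f ≈ᴹ den f *ₗ num g → f ≋ g
    cross eq = equal 1# 1∈ (*ₗ-congˡ eq)

    scale : ∀ {k l x} → k ≈ l → k *ₗ x ≈ᴹ l *ₗ x
    scale k≈l = *ₗ-cong k≈l ≈ᴹ-refl

    collect : ∀ {k l x} → k *ₗ (l *ₗ x) ≈ᴹ (k * l) *ₗ x
    collect = ≈ᴹ-sym (*ₗ-assoc _ _ _)

    reassoc : ∀ {k l k′ l′ x} → k * l ≈ k′ * l′ → k *ₗ (l *ₗ x) ≈ᴹ k′ *ₗ (l′ *ₗ x)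
    reassoc eq = ≈ᴹ-trans collect (≈ᴹ-trans (scale eq) (*ₗ-assoc _ _ _))

    ≋-refl : ∀ {f} → f ≋ f
    ≋-refl = cross ≈ᴹ-refl

    ≋-sym : ∀ {f g} → f ≋ g → g ≋ f
    ≋-sym (equal u u∈ eq) = equal u u∈ (≈ᴹ-sym eq)

    ≋-trans : ∀ {f g h} → f ≋ g → g ≋ h → f ≋ h
    ≋-trans {x / s [ _ ]} {y / t [ t∈ ]} {z / r [ _ ]} (equal u u∈ eq) (equal v v∈ eq′) =
      equal (u * v * t) ((u∈ ∙∈ v∈) ∙∈ t∈) (begin
        (u * v * t) *ₗ (r *ₗ x)       ≈⟨ reassoc (e₁ u v t r) ⟩
        (v * r) *ₗ ((u * t) *ₗ x)     ≈⟨ *ₗ-congˡ (*ₗ-assoc _ _ _) ⟩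
        (v * r) *ₗ (u *ₗ (t *ₗ x))    ≈⟨ *ₗ-congˡ eq ⟩
        (v * r) *ₗ (u *ₗ (s *ₗ y))    ≈⟨ *ₗ-congˡ collect ⟩
        (v * r) *ₗ ((u * s) *ₗ y)     ≈⟨ reassoc (e₂ u v s r) ⟩
        (u * s) *ₗ ((v * r) *ₗ y)     ≈⟨ *ₗ-congˡ (*ₗ-assoc _ _ _) ⟩
        (u * s) *ₗ (v *ₗ (r *ₗ y))    ≈⟨ *ₗ-congˡ eq′ ⟩
        (u * s) *ₗ (v *ₗ (t *ₗ z))    ≈⟨ *ₗ-congˡ collect ⟩
        (u * s) *ₗ ((v * t) *ₗ z)     ≈⟨ reassoc (e₃ u v t s) ⟩
        (u * v * t) *ₗ (s *ₗ z)       ∎)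
      where
      e₁ =
        solve 4 (λ u v t r →
          (u :* v :* t) :* r :=
          (v :* r) :* (u :* t)) refl
      e₂ =
        solve 4 (λ u v s r →
          (v :* r) :* (u :* s) :=
          (u :* s) :* (v :* r)) refl
      e₃ =
        solve 4 (λ u v t s →
          (u :* s) :* (v :* t) :=
          (u :* v :* t) :* s) refl

    combine : ∀ {k l l′ x y} → k *ₗ (l *ₗ x +ᴹ l′ *ₗ y) ≈ᴹ (k * l) *ₗ x +ᴹ (k * l′) *ₗ y
    combine = ≈ᴹ-trans (*ₗ-distribˡ _ _ _) (+ᴹ-cong collect collect)

    ⊞-cong : ∀ {f f′ g g′} → f ≋ f′ → g ≋ g′ → (f ⊞ g) ≋ (f′ ⊞ g′)
    ⊞-cong {x / s [ _ ]} {x′ / s′ [ _ ]} {y / t [ _ ]} {y′ / t′ [ _ ]}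
           (equal u u∈ eq) (equal v v∈ eq′) =
      equal (u * v) (u∈ ∙∈ v∈) (begin
        (u * v) *ₗ ((s′ * t′) *ₗ (t *ₗ x +ᴹ s *ₗ y))
          ≈⟨ ≈ᴹ-trans (*ₗ-congˡ combine) combine ⟩
        ((u * v) * ((s′ * t′) * t)) *ₗ x +ᴹ ((u * v) * ((s′ * t′) * s)) *ₗ y
          ≈⟨ +ᴹ-cong (pull (e₁ u v s′ t′ t)) (pull (e₂ u v s′ t′ s)) ⟩
        (v * t′ * t) *ₗ (u *ₗ (s′ *ₗ x)) +ᴹ (u * s′ * s) *ₗ (v *ₗ (t′ *ₗ y))
          ≈⟨ +ᴹ-cong (*ₗ-congˡ eq) (*ₗ-congˡ eq′) ⟩
        (v * t′ * t) *ₗ (u *ₗ (s *ₗ x′)) +ᴹ (u * s′ * s) *ₗ (v *ₗ (t *ₗ y′))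
          ≈⟨ +ᴹ-cong (pull (e₃ u v s t t′)) (pull (e₄ u v s t s′)) ⟨
        ((u * v) * ((s * t) * t′)) *ₗ x′ +ᴹ ((u * v) * ((s * t) * s′)) *ₗ y′
          ≈⟨ ≈ᴹ-trans (*ₗ-congˡ combine) combine ⟨
        (u * v) *ₗ ((s * t) *ₗ (t′ *ₗ x′ +ᴹ s′ *ₗ y′)) ∎)
      where
      pull : ∀ {k k₁ k₂ k₃ z} → k ≈ k₁ * (k₂ * k₃) → k *ₗ z ≈ᴹ k₁ *ₗ (k₂ *ₗ (k₃ *ₗ z))
      pull eq₀ = ≈ᴹ-trans (scale eq₀) (≈ᴹ-trans (*ₗ-assoc _ _ _) (*ₗ-congˡ (*ₗ-assoc _ _ _)))
      e₁ =
        solve 5 (λ u v s′ t′ t →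
          (u :* v) :* ((s′ :* t′) :* t) :=
          (v :* t′ :* t) :* (u :* s′)) refl
      e₂ =
        solve 5 (λ u v s′ t′ s →
          (u :* v) :* ((s′ :* t′) :* s) :=
          (u :* s′ :* s) :* (v :* t′)) refl
      e₃ =
        solve 5 (λ u v s t t′ →
          (u :* v) :* ((s :* t) :* t′) :=
          (v :* t′ :* t) :* (u :* s)) refl
      e₄ =
        solve 5 (λ u v s t s′ →
          (u :* v) :* ((s :* t) :* s′) :=
          (u :* s′ :* s) :* (v :* t)) refl

    neg-*ₗ : ∀ {k x} → k *ₗ (-ᴹ x) ≈ᴹ -ᴹ (k *ₗ x)
    neg-*ₗ {k} {x} = GroupProperties.inverseˡ-unique +ᴹ-group _ _ (begin
      k *ₗ (-ᴹ x) +ᴹ k *ₗ x ≈⟨ *ₗ-distribˡ k (-ᴹ x) x ⟨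
      k *ₗ (-ᴹ x +ᴹ x)      ≈⟨ *ₗ-congˡ (-ᴹ‿inverseˡ x) ⟩
      k *ₗ 0ᴹ               ≈⟨ *ₗ-zeroʳ k ⟩
      0ᴹ                    ∎)

    ⊟-cong : ∀ {f g} → f ≋ g → (⊟ f) ≋ (⊟ g)
    ⊟-cong (equal u u∈ eq) = equal u u∈
      (≈ᴹ-trans (neg neg-*ₗ) (≈ᴹ-trans (-ᴹ‿cong eq) (≈ᴹ-sym (neg neg-*ₗ))))
      where
      neg : ∀ {k y z} → y ≈ᴹ -ᴹ z → k *ₗ y ≈ᴹ -ᴹ (k *ₗ z)
      neg eq₀ = ≈ᴹ-trans (*ₗ-congˡ eq₀) neg-*ₗ

    ⊞-assoc : ∀ f g h → ((f ⊞ g) ⊞ h) ≋ (f ⊞ (g ⊞ h))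
    ⊞-assoc (x / s [ _ ]) (y / t [ _ ]) (z / r [ _ ]) = cross (*ₗ-cong (sym (*-assoc s t r)) (begin
      r *ₗ (t *ₗ x +ᴹ s *ₗ y) +ᴹ (s * t) *ₗ z         ≈⟨ +ᴹ-cong combine ≈ᴹ-refl ⟩
      (r * t) *ₗ x +ᴹ (r * s) *ₗ y +ᴹ (s * t) *ₗ z    ≈⟨ +ᴹ-assoc _ _ _ ⟩
      (r * t) *ₗ x +ᴹ ((r * s) *ₗ y +ᴹ (s * t) *ₗ z)  ≈⟨ +ᴹ-cong (scale (*-comm r t))
                                                          (+ᴹ-cong (scale (*-comm r s)) ≈ᴹ-refl) ⟩
      (t * r) *ₗ x +ᴹ ((s * r) *ₗ y +ᴹ (s * t) *ₗ z)  ≈⟨ +ᴹ-cong ≈ᴹ-refl combine ⟨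
      (t * r) *ₗ x +ᴹ s *ₗ (r *ₗ y +ᴹ t *ₗ z)         ∎))

    ⊞-comm : ∀ f g → (f ⊞ g) ≋ (g ⊞ f)
    ⊞-comm (x / s [ _ ]) (y / t [ _ ]) = cross (*ₗ-cong (*-comm t s) (+ᴹ-comm _ _))

    ⊞-identityˡ : ∀ f → (𝟘 ⊞ f) ≋ f
    ⊞-identityˡ (x / s [ _ ]) = cross (begin
      s *ₗ (s *ₗ 0ᴹ +ᴹ 1# *ₗ x) ≈⟨ *ₗ-congˡ (+ᴹ-cong (*ₗ-zeroʳ s) (*ₗ-identityˡ x)) ⟩
      s *ₗ (0ᴹ +ᴹ x)            ≈⟨ *ₗ-congˡ (+ᴹ-identityˡ x) ⟩
      s *ₗ x                    ≈⟨ scale (*-identityˡ s) ⟨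
      (1# * s) *ₗ x             ∎)

    ⊟-inverseˡ : ∀ f → ((⊟ f) ⊞ f) ≋ 𝟘
    ⊟-inverseˡ (x / s [ _ ]) = cross (begin
      1# *ₗ (s *ₗ (-ᴹ x) +ᴹ s *ₗ x) ≈⟨ *ₗ-identityˡ _ ⟩
      s *ₗ (-ᴹ x) +ᴹ s *ₗ x         ≈⟨ +ᴹ-cong neg-*ₗ ≈ᴹ-refl ⟩
      -ᴹ (s *ₗ x) +ᴹ s *ₗ x         ≈⟨ -ᴹ‿inverseˡ _ ⟩
      0ᴹ                            ≈⟨ *ₗ-zeroʳ _ ⟨
      (s * s) *ₗ 0ᴹ                 ∎)

    abelianGroup : AbelianGroup (m ⊔ c ⊔ p) (c ⊔ p ⊔ ℓm)
    abelianGroup = record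
      { isAbelianGroup = record
        { isGroup = record
          { isMonoid = record
            { isSemigroup = record
              { isMagma = record
                { isEquivalence = record
                  { refl = ≋-refl
                  ; sym = ≋-sym
                  ; trans = ≋-trans
                  }
                ; ∙-cong = ⊞-cong
                }
              ; assoc = ⊞-assoc
              }
            ; identity = ⊞-identityˡ , λ f →
                ≋-trans (⊞-comm f 𝟘) (⊞-identityˡ f)
            }
          ; inverse = ⊟-inverseˡ , λ f →
              ≋-trans (⊞-comm f (⊟ f)) (⊟-inverseˡ f)
          ; ⁻¹-cong = ⊟-cong
          }
        ; comm = ⊞-comm
        }
      }

  module ℛ = Additive (TensorUnit.⟨module⟩ {R = R})

  infixl 7 _⊠_
  _⊠_ : Fraction Carrier → Fraction Carrier → Fraction Carrier
  (x / s [ s∈ ]) ⊠ (y / t [ t∈ ]) = (x * y) / s * t [ s∈ ∙∈ t∈ ]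

  localizedRing : CommutativeRing (c ⊔ p) (c ⊔ ℓ ⊔ p)
  localizedRing = record
    { _*_ = _⊠_
    ; 1# = embed 1#
    ; isCommutativeRing = record
      { isRing = record
        { +-isAbelianGroup = AbelianGroup.isAbelianGroup ℛ.abelianGroup
        ; *-cong = ⊠-cong
        ; *-assoc = ⊠-assoc
        ; *-identity = ⊠-identityˡ , λ f →
            ℛ.≋-trans (⊠-comm f (embed 1#)) (⊠-identityˡ f)
        ; distrib = ⊠-distribˡ , ⊠-distribʳ
        }
      ; *-comm = ⊠-comm
      }
    }
    where
    open ℛ
    open SetoidReasoning setoid

    ⊠-cong : ∀ {f f′ g g′} → f ≋ f′ → g ≋ g′ → (f ⊠ g) ≋ (f′ ⊠ g′)
    ⊠-cong {x / s [ _ ]} {x′ / s′ [ _ ]} {y / t [ _ ]} {y′ / t′ [ _ ]}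
           (equal u u∈ eq) (equal v v∈ eq′) =
      equal (u * v) (u∈ ∙∈ v∈) (begin
        (u * v) * ((s′ * t′) * (x * y))    ≈⟨ e u v s′ t′ x y ⟩
        (u * (s′ * x)) * (v * (t′ * y))    ≈⟨ *-cong eq eq′ ⟩
        (u * (s * x′)) * (v * (t * y′))    ≈⟨ e u v s t x′ y′ ⟨
        (u * v) * ((s * t) * (x′ * y′))    ∎)
      where
      e =
        solve 6 (λ u v s t x y →
          (u :* v) :* ((s :* t) :* (x :* y)) :=
          (u :* (s :* x)) :* (v :* (t :* y))) refl

    ⊠-assoc : ∀ f g h → ((f ⊠ g) ⊠ h) ≋ (f ⊠ (g ⊠ h))
    ⊠-assoc (x / s [ _ ]) (y / t [ _ ]) (z / r [ _ ]) =
      cross (*-cong (sym (*-assoc s t r)) (*-assoc x y z))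

    ⊠-comm : ∀ f g → (f ⊠ g) ≋ (g ⊠ f)
    ⊠-comm (x / s [ _ ]) (y / t [ _ ]) = cross (*-cong (*-comm t s) (*-comm x y))

    ⊠-identityˡ : ∀ f → (embed 1# ⊠ f) ≋ f
    ⊠-identityˡ (x / s [ _ ]) = cross (*-cong (sym (*-identityˡ s)) (*-identityˡ x))

    ⊠-distribˡ : ∀ f g h → (f ⊠ (g ⊞ h)) ≋ ((f ⊠ g) ⊞ (f ⊠ h))
    ⊠-distribˡ (x / s [ _ ]) (y / t [ _ ]) (z / r [ _ ]) = cross (e s t r x y z)
      where
      e =
        solve 6 (λ s t r x y z →
          ((s :* t) :* (s :* r)) :* (x :* (r :* y :+ t :* z)) :=
          (s :* (t :* r)) :* ((s :* r) :* (x :* y) :+ (s :* t) :* (x :* z))) refl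

    ⊠-distribʳ : ∀ f g h → ((g ⊞ h) ⊠ f) ≋ ((g ⊠ f) ⊞ (h ⊠ f))
    ⊠-distribʳ (x / s [ _ ]) (y / t [ _ ]) (z / r [ _ ]) = cross (e s t r x y z)
      where
      e =
        solve 6 (λ s t r x y z →
          ((t :* s) :* (r :* s)) :* ((r :* y :+ t :* z) :* x) :=
          ((t :* r) :* s) :* ((r :* s) :* (y :* x) :+ (t :* s) :* (z :* x))) refl

  module _ (M : Module R m ℓm) where
    open Module M
    open Additive M

    infixr 7 _⊡_
    _⊡_ : Fraction Carrier → Fraction Carrierᴹ → Fraction Carrierᴹ
    (r / s [ s∈ ]) ⊡ (x / t [ t∈ ]) = (r *ₗ x) / s * t [ s∈ ∙∈ t∈ ]

    localizedModule : Module localizedRing (m ⊔ c ⊔ p) (c ⊔ p ⊔ ℓm)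
    localizedModule = record
      { isModule = IsModuleFromLeft.isModule {commutativeRing = localizedRing} (record
        { isLeftModule = record
          { isLeftSemimodule = record
            { +ᴹ-isCommutativeMonoid = 𝒜.isCommutativeMonoid
            ; isPreleftSemimodule = record
              { *ₗ-cong = ⊡-cong
              ; *ₗ-zeroˡ = ⊡-zeroˡ
              ; *ₗ-distribʳ = ⊡-distribʳ
              ; *ₗ-identityˡ = ⊡-identityˡ
              ; *ₗ-assoc = ⊡-assoc
              ; *ₗ-zeroʳ = ⊡-zeroʳ
              ; *ₗ-distribˡ = ⊡-distribˡ
              }
            }
          ; -ᴹ‿cong = 𝒜.⁻¹-cong
          ; -ᴹ‿inverse = 𝒜.inverse
          }
        })
      }
      where
      module 𝒜 = AbelianGroup abelianGroup
      open SetoidReasoning ≈ᴹ-setoid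

      ⊡-cong : ∀ {f f′ g g′} → f ℛ.≋ f′ → g ≋ g′ → (f ⊡ g) ≋ (f′ ⊡ g′)
      ⊡-cong {r / s [ _ ]} {r′ / s′ [ _ ]} {x / t [ _ ]} {x′ / t′ [ _ ]}
             (equal u u∈ eq) (equal v v∈ eq′) =
        equal (u * v) (u∈ ∙∈ v∈) (begin
          (u * v) *ₗ ((s′ * t′) *ₗ (r *ₗ x))       ≈⟨ split (e u v s′ t′ r) ⟩
          (u * (s′ * r)) *ₗ (v *ₗ (t′ *ₗ x))       ≈⟨ *ₗ-cong eq eq′ ⟩
          (u * (s * r′)) *ₗ (v *ₗ (t *ₗ x′))       ≈⟨ split (e u v s t r′) ⟨
          (u * v) *ₗ ((s * t) *ₗ (r′ *ₗ x′))       ∎)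
        where
        split : ∀ {k l h k′ l′ h′ z} → k * (l * h) ≈ k′ * (l′ * h′) →
                k *ₗ (l *ₗ (h *ₗ z)) ≈ᴹ k′ *ₗ (l′ *ₗ (h′ *ₗ z))
        split eq₀ = ≈ᴹ-trans (*ₗ-congˡ collect)
          (≈ᴹ-trans (reassoc eq₀) (*ₗ-congˡ (*ₗ-assoc _ _ _)))
        e =
          solve 5 (λ u v s t r →
            (u :* v) :* ((s :* t) :* r) :=
            (u :* (s :* r)) :* (v :* t)) refl

      ⊡-zeroˡ : ∀ f → (embed 0# ⊡ f) ≋ 𝟘
      ⊡-zeroˡ (x / s [ _ ]) = cross (≈ᴹ-trans
        (*ₗ-congˡ (*ₗ-zeroˡ x)) (≈ᴹ-trans (*ₗ-zeroʳ _) (≈ᴹ-sym (*ₗ-zeroʳ _))))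

      ⊡-zeroʳ : ∀ f → (f ⊡ 𝟘) ≋ 𝟘
      ⊡-zeroʳ (r / s [ _ ]) = cross (≈ᴹ-trans
        (*ₗ-congˡ (*ₗ-zeroʳ r)) (≈ᴹ-trans (*ₗ-zeroʳ _) (≈ᴹ-sym (*ₗ-zeroʳ _))))

      ⊡-identityˡ : ∀ f → (embed 1# ⊡ f) ≋ f
      ⊡-identityˡ (x / s [ _ ]) = cross
        (*ₗ-cong (sym (*-identityˡ s)) (*ₗ-identityˡ x))

      ⊡-assoc : ∀ f g h → ((f ⊠ g) ⊡ h) ≋ (f ⊡ (g ⊡ h))
      ⊡-assoc (r / s [ _ ]) (q / t [ _ ]) (x / w [ _ ]) = cross
        (*ₗ-cong (sym (*-assoc s t w)) (*ₗ-assoc r q x))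

      ⊡-distribˡ : ∀ f g h → (f ⊡ (g ⊞ h)) ≋ ((f ⊡ g) ⊞ (f ⊡ h))
      ⊡-distribˡ (r / s [ _ ]) (x / t [ _ ]) (y / w [ _ ]) = cross (begin
        ((s * t) * (s * w)) *ₗ (r *ₗ (w *ₗ x +ᴹ t *ₗ y))
          ≈⟨ ≈ᴹ-trans (*ₗ-congˡ combine) combine ⟩
        (((s * t) * (s * w)) * (r * w)) *ₗ x +ᴹ (((s * t) * (s * w)) * (r * t)) *ₗ y
          ≈⟨ +ᴹ-cong (scale (e₁ s t w r)) (scale (e₂ s t w r)) ⟩
        ((s * (t * w)) * ((s * w) * r)) *ₗ x +ᴹ ((s * (t * w)) * ((s * t) * r)) *ₗ y
          ≈⟨ combine ⟨
        (s * (t * w)) *ₗ (((s * w) * r) *ₗ x +ᴹ ((s * t) * r) *ₗ y)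
          ≈⟨ *ₗ-congˡ (+ᴹ-cong collect collect) ⟨
        (s * (t * w)) *ₗ ((s * w) *ₗ (r *ₗ x) +ᴹ (s * t) *ₗ (r *ₗ y)) ∎)
        where
        e₁ =
          solve 4 (λ s t w r →
            ((s :* t) :* (s :* w)) :* (r :* w) :=
            (s :* (t :* w)) :* ((s :* w) :* r)) refl
        e₂ =
          solve 4 (λ s t w r →
            ((s :* t) :* (s :* w)) :* (r :* t) :=
            (s :* (t :* w)) :* ((s :* t) :* r)) refl

      ⊡-distribʳ : ∀ f g h → ((g ℛ.⊞ h) ⊡ f) ≋ ((g ⊡ f) ⊞ (h ⊡ f))
      ⊡-distribʳ (x / s [ _ ]) (r / t [ _ ]) (q / w [ _ ]) = cross (begin
        ((t * s) * (w * s)) *ₗ ((w * r + t * q) *ₗ x)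
          ≈⟨ reassoc (e s t w r q) ⟩
        ((t * w) * s) *ₗ (((w * s) * r + (t * s) * q) *ₗ x)
          ≈⟨ *ₗ-congˡ (≈ᴹ-trans (*ₗ-distribʳ _ _ _) (+ᴹ-cong (*ₗ-assoc _ _ _) (*ₗ-assoc _ _ _))) ⟩
        ((t * w) * s) *ₗ ((w * s) *ₗ (r *ₗ x) +ᴹ (t * s) *ₗ (q *ₗ x)) ∎)
        where
        e =
          solve 5 (λ s t w r q →
            ((t :* s) :* (w :* s)) :* (w :* r :+ t :* q) :=
            ((t :* w) :* s) :* ((w :* s) :* r :+ (t :* s) :* q)) refl

------------------------------------------------------------------------
-- Integral domains, their fraction fields and their localizations

record IsIntegralDomain (R : CommutativeRing c ℓ) : Set (c ⊔ ℓ) where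
  open CommutativeRing R
  field
    1≉0            : ¬ 1# ≈ 0#
    noZeroDivisors : ∀ {x y} → x * y ≈ 0# → x ≈ 0# ⊎ y ≈ 0#

  nonzero-* : ∀ {x y} → ¬ x ≈ 0# → ¬ y ≈ 0# → ¬ x * y ≈ 0#
  nonzero-* x≉0 y≉0 xy≈0 = [ x≉0 , y≉0 ]′ (noZeroDivisors xy≈0)

record IntegralDomain c ℓ : Set (suc (c ⊔ ℓ)) where
  field
    commutativeRing  : CommutativeRing c ℓ
    isIntegralDomain : IsIntegralDomain commutativeRing
  open CommutativeRing commutativeRing public
  open IsIntegralDomain isIntegralDomain public

module _ (D : IntegralDomain c ℓ) (S : MultiplicativeSet (IntegralDomain.commutativeRing D) p)
         (S-nonzero : ∀ {x} → x ∈ MultiplicativeSet.member S →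
                      ¬ IntegralDomain._≈_ D x (IntegralDomain.0# D))
         where
  open IntegralDomain D
  open Localization commutativeRing S

  private module L = CommutativeRing localizedRing

  S-cancel : ∀ {u x} → u ∈ MultiplicativeSet.member S → u * x ≈ 0# → x ≈ 0#
  S-cancel u∈S ux≈0 with noZeroDivisors ux≈0
  ... | inj₁ u≈0 = contradiction u≈0 (S-nonzero u∈S)
  ... | inj₂ x≈0 = x≈0

  num≈0⇒≈0 : ∀ {f} → num f ≈ 0# → f L.≈ L.0#
  num≈0⇒≈0 x≈0 = ℛ.cross (trans (*-congˡ x≈0) (trans (zeroʳ _) (sym (zeroʳ _))))

  ≈0⇒num≈0 : ∀ {f} → f L.≈ L.0# → num f ≈ 0#
  ≈0⇒num≈0 (ℛ.equal u u∈S eq) = trans (sym (*-identityˡ _))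
    (S-cancel u∈S (trans eq (trans (*-congˡ (zeroʳ _)) (zeroʳ _))))

  localizedDomain : IntegralDomain (c ⊔ p) (c ⊔ ℓ ⊔ p)
  localizedDomain = record
    { commutativeRing = localizedRing
    ; isIntegralDomain = record
      { 1≉0 = λ 1≈0 → 1≉0 (≈0⇒num≈0 1≈0)
      ; noZeroDivisors = λ fg≈0 →
          Sum.map num≈0⇒≈0 num≈0⇒≈0 (noZeroDivisors (≈0⇒num≈0 fg≈0))
      }
    }

module _ (D : IntegralDomain c ℓ) where
  open IntegralDomain D

  nonzeros : MultiplicativeSet commutativeRing ℓ
  nonzeros = record
    { member = λ x → ¬ x ≈ 0# ; 1∈ = 1≉0 ; *-closed = nonzero-* }

  FractionField : IntegralDomain (c ⊔ ℓ) (c ⊔ ℓ)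
  FractionField = localizedDomain D nonzeros (λ x≉0 → x≉0)

module _ (D : IntegralDomain c ℓ) (𝓜 : MSpec (IntegralDomain.commutativeRing D)) where
  open IntegralDomain D
  open MSpec 𝓜

  maximal⇒prime : ∀ {x y} → x ∉ member → y ∉ member → x * y ∉ member
  maximal⇒prime {x} {y} x∉𝓜 y∉𝓜 xy∈𝓜 =
    x∉𝓜 (proj₂ isMaximal 𝓜+x 𝓜⊆𝓜+x 𝓜+x-proper
      (0# , 1# , 0∈ , trans (sym (*-identityˡ x)) (sym (+-identityˡ _))))
    where
    open SetoidReasoning setoid
    open CommutativeSemiringSolver commutativeSemiring using (solve; _:=_; _:*_; _:+_)
    𝓜+x : Ideal commutativeRing
    𝓜+x = record
      { member = λ z → ∃₂ λ w r → w ∈ member × z ≈ w + r * x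
      ; respects = λ z≈z′ (w , r , w∈𝓜 , eq) → w , r , w∈𝓜 , trans (sym z≈z′) eq
      ; 0∈ = 0# , 0# , 0∈ , sym (trans (+-identityˡ _) (zeroˡ x))
      ; +-closed = λ (w , r , w∈𝓜 , eq) (w′ , r′ , w′∈𝓜 , eq′) →
          w + w′ , r + r′ , +-closed w∈𝓜 w′∈𝓜 ,
          trans (+-cong eq eq′)
            (solve 5 (λ w w′ r r′ x →
              (w :+ r :* x) :+ (w′ :+ r′ :* x) :=
              (w :+ w′) :+ (r :+ r′) :* x) refl w w′ r r′ x)
      ; *-closed = λ q (w , r , w∈𝓜 , eq) → q * w , q * r , *-closed q w∈𝓜 ,
          trans (*-congˡ eq) (trans (distribˡ q w _) (+-congˡ (sym (*-assoc q r x))))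
      }
    𝓜⊆𝓜+x : member ⊆ Ideal.member 𝓜+x
    𝓜⊆𝓜+x {w} w∈𝓜 = w , 0# , w∈𝓜 , sym (trans (+-congˡ (zeroˡ x)) (+-identityʳ w))
    𝓜+x-proper : IsProper commutativeRing 𝓜+x
    𝓜+x-proper (w , r , w∈𝓜 , eq) = y∉𝓜 (respects (sym (begin
      y                      ≈⟨ *-identityʳ y ⟨
      y * 1#                 ≈⟨ *-congˡ eq ⟩
      y * (w + r * x)        ≈⟨ solve 4 (λ w r x y →
                                  y :* (w :+ r :* x) := y :* w :+ r :* (x :* y)) refl w r x y ⟩
      y * w + r * (x * y)    ∎))
      (+-closed (*-closed y w∈𝓜) (*-closed r xy∈𝓜)))

  complement : MultiplicativeSet commutativeRing (c ⊔ ℓ)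
  complement = record
    { member = ∁ member ; 1∈ = proj₁ isMaximal ; *-closed = maximal⇒prime }

  complement-nonzero : ∀ {x} → x ∉ member → ¬ x ≈ 0#
  complement-nonzero x∉𝓜 x≈0 = x∉𝓜 (respects (sym x≈0) 0∈)

  LocalDomain : IntegralDomain (c ⊔ ℓ) (c ⊔ ℓ)
  LocalDomain = localizedDomain D complement complement-nonzero

  LocalModule : Module commutativeRing m ℓm →
                Module (IntegralDomain.commutativeRing LocalDomain) (m ⊔ c ⊔ ℓ) (c ⊔ ℓ ⊔ ℓm)
  LocalModule = Localization.localizedModule commutativeRing complement

  open Localization using (_/_[_]; embed)

  private
    module Q = IntegralDomain (FractionField D)
    module L = IntegralDomain LocalDomain
    module QL = IntegralDomain (FractionField LocalDomain)

  local→Q : L.Carrier → Q.Carrier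
  local→Q (x / s [ s∈ ]) = x / s [ complement-nonzero s∈ ]

  -- q ∈ Q(D) lies in the subring D_𝓜.
  LiesInLocal : Pred Q.Carrier (c ⊔ ℓ)
  LiesInLocal q = ∃ λ x → local→Q x Q.≈ q

  embed-nonzero : ∀ {x} → ¬ x ≈ 0# → ¬ embed commutativeRing complement x L.≈ L.0#
  embed-nonzero x≉0 eq = x≉0 (≈0⇒num≈0 D complement complement-nonzero eq)

  -- The map Q(D) → Q(D_𝓜) induced by D → D_𝓜.
  Q→Qlocal : Q.Carrier → QL.Carrier
  Q→Qlocal (x / y [ y≉0 ]) =
    embed commutativeRing complement x / embed commutativeRing complement y [ embed-nonzero y≉0 ]

------------------------------------------------------------------------
-- The group of divisibility

module Divisibility (D : IntegralDomain c ℓ) where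
  open IntegralDomain D
  open RawSemiringDefs (Semiring.rawSemiring semiring) using (_∣_)
  open Localization commutativeRing (nonzeros D) using (embed)

  private module Q = IntegralDomain (FractionField D)

  -- Elements of Γ are represented by elements of Q(D)^×; the equality of Γ is _≈ᵞ_.
  Γ : Set (c ⊔ ℓ)
  Γ = ∃ λ q → ¬ q Q.≈ Q.0#

  infix 4 _≈ᵞ_ _≤ᵞ_
  infixl 7 _·ᵞ_

  _≈ᵞ_ _≤ᵞ_ : Γ → Γ → Set (c ⊔ ℓ)
  (q , _) ≈ᵞ (r , _) = ∃ λ u → u ∣ 1# × r Q.≈ embed u Q.* q
  (q , _) ≤ᵞ (r , _) = ∃ λ x → r Q.≈ embed x Q.* q

  _·ᵞ_ : Γ → Γ → Γ
  (q , q≉0) ·ᵞ (r , r≉0) = q Q.* r , Q.nonzero-* q≉0 r≉0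

  v : (x : Carrier) → ¬ x ≈ 0# → Γ
  v x x≉0 = embed x , λ eq → x≉0 (≈0⇒num≈0 D (nonzeros D) (λ y≉0 → y≉0) eq)

  1ᵞ : Γ
  1ᵞ = v 1# 1≉0

  IsMeet : Γ → Γ → Γ → Set (c ⊔ ℓ)
  IsMeet δ₁ δ₂ μ = μ ≤ᵞ δ₁ × μ ≤ᵞ δ₂ × (∀ ε → ε ≤ᵞ δ₁ → ε ≤ᵞ δ₂ → ε ≤ᵞ μ)

  IsPositive : Γ → Set (c ⊔ ℓ)
  IsPositive δ = ∃₂ λ x x≉0 → δ ≈ᵞ v x x≉0

  Γ⁺ : Set (c ⊔ ℓ)
  Γ⁺ = ∃ IsPositive

open Divisibility public using (Γ; Γ⁺; IsPositive)

Γ→Γlocal : (D : IntegralDomain c ℓ) (𝓜 : MSpec (IntegralDomain.commutativeRing D)) →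
           Γ D → Γ (LocalDomain D 𝓜)
Γ→Γlocal D 𝓜 (q , q≉0) = Q→Qlocal D 𝓜 q , λ eq →
  q≉0 (num≈0⇒≈0 D (nonzeros D) (λ y≉0 → y≉0)
    (≈0⇒num≈0 D (complement D 𝓜) (complement-nonzero D 𝓜)
      (≈0⇒num≈0 (LocalDomain D 𝓜) (nonzeros (LocalDomain D 𝓜)) (λ y≉0 → y≉0) eq)))

------------------------------------------------------------------------
-- Valued modules

module _ (D : IntegralDomain c ℓ) where
  open IntegralDomain D
  open Divisibility D using (_≈ᵞ_; _·ᵞ_; v; 1ᵞ; IsMeet)

  -- A model of T_{D,V,div}.  As Γ⁺ is a setoid, V-respects is what makes
  -- V a family of predicates indexed by the positive part of Γ.
  record ValuedModule m ℓm ℓv : Set (c ⊔ ℓ ⊔ suc (m ⊔ ℓm ⊔ ℓv)) where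
    field
      baseModule : Module commutativeRing m ℓm
    open Module baseModule public
    field
      V          : Γ⁺ D → Pred Carrierᴹ ℓv
      V-respects : ∀ {δ ε x y} → proj₁ δ ≈ᵞ proj₁ ε → x ≈ᴹ y → x ∈ V δ → y ∈ V ε
      V-zero     : ∀ {δ} → 0ᴹ ∈ V δ
      V-+        : ∀ {δ₁ δ₂ μ x y} → IsMeet (proj₁ δ₁) (proj₁ δ₂) (proj₁ μ) →
                   x ∈ V δ₁ → y ∈ V δ₂ → x +ᴹ y ∈ V μ
      V-∧        : ∀ {δ ν x} {μ : Γ⁺ D} → IsMeet (proj₁ δ) (proj₁ μ) (proj₁ ν) → x ∈ V δ → x ∈ V ν
      V-*        : ∀ {δ ε a x} (a≉0 : ¬ a ≈ 0#) → proj₁ ε ≈ᵞ proj₁ δ ·ᵞ v a a≉0 →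
                   x ∈ V δ → x *ᵣ a ∈ V ε
      V-1        : ∀ {δ} → proj₁ δ ≈ᵞ 1ᵞ → ∀ x → x ∈ V δ
      V-div      : ∀ {δ a x} (a≉0 : ¬ a ≈ 0#) → proj₁ δ ≈ᵞ v a a≉0 →
                   x ∈ V δ → ∃ λ y → y *ᵣ a ≈ᴹ x

  -- V_δ(N) = N a whenever δ = v(a).
  divisiblePart : (N : Module commutativeRing m ℓm) → Γ⁺ D → Pred (Module.Carrierᴹ N) (m ⊔ ℓm)
  divisiblePart N (δ , a , _) x = ∃ λ y → y *ᵣ a ≈ᴹ x
    where open Module N

------------------------------------------------------------------------
-- Positive primitive formulas

-- The language of modules over a set S of scalars, with unary predicates
-- V[ δ ] for δ in Δ; formulas have their free variables in Fin n.

data Term (S : Set s) (n : ℕ) : Set s where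
  var : Fin n → Term S n
  𝟎   : Term S n
  _⊕_ : Term S n → Term S n → Term S n
  ⊖_  : Term S n → Term S n
  _⊙_ : Term S n → S → Term S n

data Atomic (S : Set s) (Δ : Set d) (n : ℕ) : Set (s ⊔ d) where
  _≐ᵗ_ : Term S n → Term S n → Atomic S Δ n
  V[_] : Δ → Term S n → Atomic S Δ n

Conjunction : Set s → Set d → ℕ → Set (s ⊔ d)
Conjunction S Δ n = List (Atomic S Δ n)

-- The bound variables are the last #bound ones.
record PPFormula (S : Set s) (Δ : Set d) (n : ℕ) : Set (s ⊔ d) where
  constructor ∃[_]_
  field
    #bound : ℕ
    matrix : Conjunction S Δ (n ℕ.+ #bound)

record Structure (S : Set s) (Δ : Set d) m ℓm ℓv : Set (s ⊔ d ⊔ suc (m ⊔ ℓm ⊔ ℓv)) where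
  field
    abelianGroup : AbelianGroup m ℓm
  open AbelianGroup abelianGroup public using (Carrier; _≈_)
  field
    scale     : Carrier → S → Carrier
    predicate : Δ → Pred Carrier ℓv

module _ {S : Set s} {Δ : Set d} (N : Structure S Δ m ℓm ℓv) where
  open Structure N
  open AbelianGroup abelianGroup using (_∙_; ε; _⁻¹)

  ⟦_⟧ : ∀ {n} → Term S n → Vector Carrier n → Carrier
  ⟦ var i ⟧ u = u i
  ⟦ 𝟎 ⟧     u = ε
  ⟦ t ⊕ r ⟧ u = ⟦ t ⟧ u ∙ ⟦ r ⟧ u
  ⟦ ⊖ t ⟧   u = ⟦ t ⟧ u ⁻¹
  ⟦ t ⊙ a ⟧ u = scale (⟦ t ⟧ u) a

  HoldsAtomic : ∀ {n} → Vector Carrier n → Pred (Atomic S Δ n) (ℓm ⊔ ℓv)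
  HoldsAtomic u (t ≐ᵗ r)  = Lift ℓv (⟦ t ⟧ u ≈ ⟦ r ⟧ u)
  HoldsAtomic u (V[ δ ] t) = Lift ℓm (⟦ t ⟧ u ∈ predicate δ)

  HoldsConjunction : ∀ {n} → Conjunction S Δ n → Pred (Vector Carrier n) (s ⊔ d ⊔ ℓm ⊔ ℓv)
  HoldsConjunction θ u = All (HoldsAtomic u) θ

  HoldsPP : ∀ {n} → PPFormula S Δ n → Pred (Vector Carrier n) (s ⊔ d ⊔ m ⊔ ℓm ⊔ ℓv)
  HoldsPP (∃[ k ] θ) u = ∃ λ (x : Vector Carrier k) → HoldsConjunction θ (u ++ x)

-- M_V as an 𝓛_{D,V}-structure.
valuedStructure : (D : IntegralDomain c ℓ) → ValuedModule D m ℓm ℓv →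
                  Structure (IntegralDomain.Carrier D) (Γ⁺ D) m ℓm ℓv
valuedStructure D M = record
  { abelianGroup = +ᴹ-abelianGroup ; scale = _*ᵣ_ ; predicate = V }
  where open ValuedModule M

module _ (D : IntegralDomain c ℓ) (O : Pred (MSpec (IntegralDomain.commutativeRing D)) p) where

  -- The scalars and the predicates common to the languages 𝓛_{D_𝓜,V}, 𝓜 ∈ O.

  ScalarsOver : Set (suc (c ⊔ ℓ) ⊔ p)
  ScalarsOver = ∃ λ q → ∀ {𝓜} → 𝓜 ∈ O → q ∈ LiesInLocal D 𝓜

  ValuesOver : Set (suc (c ⊔ ℓ) ⊔ p)
  ValuesOver = ∃ λ δ → ∀ {𝓜} → 𝓜 ∈ O → IsPositive (LocalDomain D 𝓜) (Γ→Γlocal D 𝓜 δ)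

  localStructure : Module (IntegralDomain.commutativeRing D) m ℓm →
                   ∀ {𝓜} → 𝓜 ∈ O → Structure ScalarsOver ValuesOver _ _ _
  localStructure M {𝓜} 𝓜∈O = record
    { abelianGroup = +ᴹ-abelianGroup
    ; scale        = λ x (_ , q∈) → x *ᵣ proj₁ (q∈ 𝓜∈O)
    ; predicate    = λ (δ , δ⁺) → divisiblePart (LocalDomain D 𝓜) (LocalModule D 𝓜 M)
                       (Γ→Γlocal D 𝓜 δ , δ⁺ 𝓜∈O)
    }
    where open Module (LocalModule D 𝓜 M)

-- The image of a tuple of elements of M in M_𝓜.
localTuple : (D : IntegralDomain c ℓ) (M : Module (IntegralDomain.commutativeRing D) m ℓm)
             (𝓜 : MSpec (IntegralDomain.commutativeRing D)) {n : ℕ} →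
             Vector (Module.Carrierᴹ M) n → Vector (Module.Carrierᴹ (LocalModule D 𝓜 M)) n
localTuple D M 𝓜 = map (Localization.embed (IntegralDomain.commutativeRing D) (complement D 𝓜))

module Submission where

open import Defs
open import Algebra.Bundles using (CommutativeMonoid; CommutativeRing; Semiring)
import Algebra.Definitions.RawSemiring as RawSemiringDefs
open import Algebra.Module.Bundles using (Module)
import Algebra.Module.Construct.TensorUnit as TensorUnit
import Algebra.Properties.AbelianGroup as AbelianGroupProperties
import Algebra.Properties.CommutativeMonoid.Sum as Sum
import Algebra.Properties.CommutativeSemigroup as CommutativeSemigroupProperties
import Algebra.Properties.Monoid.Divisibility as MonoidDivisibility
import Algebra.Properties.Ring as RingProperties
import Algebra.Solver.Ring.NaturalCoefficients.Default as CommutativeSemiringSolver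
open import Axiom.ExcludedMiddle using (ExcludedMiddle)
open import Data.Fin.Base using (Fin; zero; suc; splitAt)
open import Data.List.Base as List using (List; []; _∷_; length)
open import Data.List.Relation.Unary.All as All using (All; []; _∷_)
import Data.List.Relation.Unary.All.Properties as All
open import Data.Nat.Base as ℕ using (ℕ; zero; suc)
open import Data.Product.Base using (Σ; ∃; _×_; _,_; proj₁; proj₂)
open import Data.Sum.Base using (_⊎_; inj₁; inj₂; [_,_]′)
open import Data.Vec.Base as Vec using (Vec; []; _∷_)
open import Data.Vec.Functional as Vector using (Vector; _++_)
open import Data.Vec.Relation.Unary.All as Allⱽ using ([]; _∷_) renaming (All to Allⱽ)
import Data.Vec.Relation.Unary.All.Properties as Allⱽ
open import Function.Base using (id; _∘_)
open import Function.Bundles using (_⇔_; mk⇔; Equivalence)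
open import Level using (Level; _⊔_; 0ℓ; lift)
open import Relation.Binary.Bundles using (Poset)
open import Relation.Binary.PropositionalEquality.Core as ≡ using ()
import Relation.Binary.Reasoning.Setoid as SetoidReasoning
open import Relation.Nullary.Decidable.Core
  using (Dec; yes; no; True; toWitness; fromWitness; decidable-stable)
open import Relation.Nullary.Negation.Core using (¬_; contradiction)
open import Relation.Unary using (Pred; _∈_; _∉_; _⊆_)

-- The partition {MSpec(B)} suffices, because φ is equivalent over B itself to a
-- conjunction of conditions a ∣ t(𝐲) with a ∈ B; such a condition holds in M iff it
-- holds in every M_𝓜, since {s : a ∣ s t} is an ideal.
--
-- As V_{v(a)} is divisibility by a, φ asserts the solvability of a linear system.
-- Good factorization makes B an elementary divisor ring (Helmer, Kaplansky): two rows
-- r, s generating the unit ideal admit a unimodular row among their combinations.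
-- If some minor μ = rᵢsⱼ − rⱼsᵢ is nonzero, then with a = gcd(r) and a factorization
-- μ = q d, gcd(q, a) = 1, a ∈ rad(d), the row r + q s works: a maximal ideal containing
-- it contains μ, hence q or d; q would force a, against coprimality, while d forces
-- a, so r, so q s, so s.  Hence row operations of determinant 1 bring the
-- gcd d of all coefficients into one row, d = y · r with r = d r′.  Clearing the other
-- rows along y leaves rows orthogonal to y, and the first equation x · r = t then only
-- says d ∣ t, as x may be moved along y.  Induct on the number of rows.

private
  variable
    c ℓ m ℓm ℓv : Level
    k n N : ℕ

-- Excluded middle brings the chain unions and the ideals below, whose natural membership
-- predicates are too large, down to the level prescribed by Ideal.
module Resizing (em : ∀ {a} → ExcludedMiddle a) where

  record Resize {a} b (P : Set a) : Set b where
    constructor ⟨_⟩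
    field truth : True (em {P = P})

  resize : ∀ {a b} {P : Set a} → P → Resize b P
  resize p = ⟨ fromWitness p ⟩

  unresize : ∀ {a b} {P : Set a} → Resize b P → P
  unresize ⟨ t ⟩ = toWitness t

-- Existence of maximal ideals.

module MaximalIdeals
  (em : ∀ {a} → ExcludedMiddle a)
  (zorn : ∀ {a ℓ₁ ℓ₂ p} → ZornsLemma a ℓ₁ ℓ₂ p)
  (R : CommutativeRing c ℓ) where

  open CommutativeRing R using (0#; 1#; _+_; _*_)
  open Ideal
  open Resizing em

  -- Zorn's lemma for the proper ideals containing `I`, ordered by inclusion. Equality in the poset
  -- is mutual inclusion, so antisymmetry is mere pairing.
  proper⇒⊆maximal : (I : Ideal R) → IsProper R I →
                    ∃ λ (𝓜 : MSpec R) → member I ⊆ MSpec.member 𝓜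
  proper⇒⊆maximal I I-proper = record
    { ideal = Z
    ; isMaximal = Z-proper , λ J Z⊆J J-proper →
        proj₁ (maximal {J , J-proper , Z⊆J ∘ I⊆Z} Z⊆J)
    } , I⊆Z
    where
    properAboveI : Poset _ _ _
    properAboveI = record
      { Carrier = ∃ λ J → IsProper R J × member I ⊆ member J
      ; _≈_ = λ (J , _) (K , _) → member J ⊆ member K × member K ⊆ member J
      ; _≤_ = λ (J , _) (K , _) → member J ⊆ member K
      ; isPartialOrder = record
        { isPreorder = record
          { isEquivalence = record
            { refl = id , id
            ; sym = λ (p , q) → q , p
            ; trans = λ (p , q) (p′ , q′) → p′ ∘ p , q ∘ q′
            }
          ; reflexive = proj₁
          ; trans = λ p q → q ∘ p
          }
        ; antisym = _,_
        }
      }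
    open Poset properAboveI using (Carrier; _≤_)

    bounded : (C : Pred Carrier 0ℓ) →
              (∀ {J K} → J ∈ C → K ∈ C → J ≤ K ⊎ K ≤ J) →
              ∃ λ U → ∀ {J} → J ∈ C → J ≤ U
    bounded C total =
      (⋃C ,
       (λ 1∈ → [ I-proper , (λ ((_ , J-proper , _) , _ , 1∈J) → J-proper 1∈J) ]′ (unresize 1∈)) ,
       λ x∈I → resize (inj₁ x∈I)) ,
      λ {J} J∈C x∈J → resize (inj₂ (J , J∈C , x∈J))
      where
      -- `I` itself is joined to the union, so that the empty chain also gets an ideal containing
      -- `I` as its upper bound.
      InUnion : Pred (CommutativeRing.Carrier R) _
      InUnion x = x ∈ member I ⊎ ∃ λ J → J ∈ C × x ∈ member (proj₁ J)

      add : ∀ {x y} → InUnion x → InUnion y → InUnion (x + y)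
      add (inj₁ x∈I) (inj₁ y∈I) = inj₁ (+-closed I x∈I y∈I)
      add (inj₁ x∈I) (inj₂ ((J , J′@(_ , I⊆J)) , J∈C , y∈J)) =
        inj₂ ((J , J′) , J∈C , +-closed J (I⊆J x∈I) y∈J)
      add (inj₂ ((J , J′@(_ , I⊆J)) , J∈C , x∈J)) (inj₁ y∈I) =
        inj₂ ((J , J′) , J∈C , +-closed J x∈J (I⊆J y∈I))
      add (inj₂ (J , J∈C , x∈J)) (inj₂ (K , K∈C , y∈K)) with total J∈C K∈C
      ... | inj₁ J≤K = inj₂ (K , K∈C , +-closed (proj₁ K) (J≤K x∈J) y∈K)
      ... | inj₂ K≤J = inj₂ (J , J∈C , +-closed (proj₁ J) x∈J (K≤J y∈K))

      ⋃C : Ideal R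
      ⋃C = record
        { member = λ x → Resize _ (InUnion x)
        ; respects = λ x≈y x∈ → resize
            ([ inj₁ ∘ respects I x≈y
             , (λ (J , J∈C , x∈J) → inj₂ (J , J∈C , respects (proj₁ J) x≈y x∈J)) ]′ (unresize x∈))
        ; 0∈ = resize (inj₁ (0∈ I))
        ; +-closed = λ x∈ y∈ → resize (add (unresize x∈) (unresize y∈))
        ; *-closed = λ r x∈ → resize
            ([ inj₁ ∘ *-closed I r
             , (λ (J , J∈C , x∈J) → inj₂ (J , J∈C , *-closed (proj₁ J) r x∈J)) ]′ (unresize x∈))
        }

    zorned = zorn properAboveI bounded
    Z = proj₁ (proj₁ zorned)
    Z-proper = proj₁ (proj₂ (proj₁ zorned))
    I⊆Z : member I ⊆ member Z
    I⊆Z = proj₂ (proj₂ (proj₁ zorned))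
    maximal : ∀ {J} → proj₁ zorned ≤ J →
              member (proj₁ J) ⊆ member Z × member Z ⊆ member (proj₁ J)
    maximal {J} = proj₂ zorned {J}

-- Linear combinations and dot products.

module Combination (R : CommutativeRing c ℓ) where
  open CommutativeRing R using (Carrier; _+_; _*_)

  combination : Vector Carrier k → Vector Carrier k → Carrier → Carrier → Vector Carrier k
  combination r s α β i = r i * α + s i * β

-- Scalars act on the right, as in the terms t ⊙ a.
module DotProduct {R : CommutativeRing c ℓ} (M : Module R m ℓm) where
  open CommutativeRing R using (Carrier; _≈_; 0#; 1#; _+_; _*_; refl)
  open Combination R
  open Module M
  open Sum +ᴹ-commutativeMonoid using (sum; sum-cong-≋; ∑-distrib-+; sum-replicate-zero)
  open SetoidReasoning ≈ᴹ-setoid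

  infix 8 _·_
  _·_ : Vector Carrierᴹ k → Vector Carrier k → Carrierᴹ
  x · r = sum λ i → x i *ᵣ r i

  ·-cong : {x y : Vector Carrierᴹ k} {r s : Vector Carrier k} →
           (∀ i → x i ≈ᴹ y i) → (∀ i → r i ≈ s i) → x · r ≈ᴹ y · s
  ·-cong x≈y r≈s = sum-cong-≋ λ i → *ᵣ-cong (x≈y i) (r≈s i)

  ·-distribˡ : (x : Vector Carrierᴹ k) (r s : Vector Carrier k) →
               x · (λ i → r i + s i) ≈ᴹ x · r +ᴹ x · s
  ·-distribˡ x r s = ≈ᴹ-trans (sum-cong-≋ λ i → *ᵣ-distribˡ (x i) (r i) (s i))
    (∑-distrib-+ (λ i → x i *ᵣ r i) (λ i → x i *ᵣ s i))

  ·-distribʳ : (x y : Vector Carrierᴹ k) (r : Vector Carrier k) →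
               (λ i → x i +ᴹ y i) · r ≈ᴹ x · r +ᴹ y · r
  ·-distribʳ x y r = ≈ᴹ-trans (sum-cong-≋ λ i → *ᵣ-distribʳ (r i) (x i) (y i))
    (∑-distrib-+ (λ i → x i *ᵣ r i) (λ i → y i *ᵣ r i))

  sum-*ᵣ : (x : Vector Carrierᴹ k) (a : Carrier) → sum (λ i → x i *ᵣ a) ≈ᴹ sum x *ᵣ a
  sum-*ᵣ {zero}  x a = ≈ᴹ-sym (*ᵣ-zeroˡ a)
  sum-*ᵣ {suc k} x a = ≈ᴹ-trans (+ᴹ-cong ≈ᴹ-refl (sum-*ᵣ (Vector.tail x) a))
                                (≈ᴹ-sym (*ᵣ-distribʳ a _ _))

  ·-*ʳ : (x : Vector Carrierᴹ k) (r : Vector Carrier k) (a : Carrier) →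
         x · (λ i → r i * a) ≈ᴹ (x · r) *ᵣ a
  ·-*ʳ x r a = ≈ᴹ-trans (sum-cong-≋ λ i → ≈ᴹ-sym (*ᵣ-assoc (x i) (r i) a))
    (sum-*ᵣ (λ i → x i *ᵣ r i) a)

  ·-combination : (x : Vector Carrierᴹ k) (r s : Vector Carrier k) (α β : Carrier) →
                  x · combination r s α β ≈ᴹ (x · r) *ᵣ α +ᴹ (x · s) *ᵣ β
  ·-combination x r s α β = ≈ᴹ-trans (·-distribˡ x (λ i → r i * α) (λ i → s i * β))
    (+ᴹ-cong (·-*ʳ x r α) (·-*ʳ x s β))

  ·-zeroʳ : (x : Vector Carrierᴹ k) {r : Vector Carrier k} → (∀ i → r i ≈ 0#) → x · r ≈ᴹ 0ᴹ
  ·-zeroʳ {k} x r≈0 = ≈ᴹ-trans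
    (sum-cong-≋ λ i → ≈ᴹ-trans (*ᵣ-congˡ (r≈0 i)) (*ᵣ-zeroʳ (x i))) (sum-replicate-zero k)

  unit : Fin k → Vector Carrier k
  unit zero    = 1# Vector.∷ λ _ → 0#
  unit (suc i) = 0# Vector.∷ unit i

  ·-unit : (x : Vector Carrierᴹ k) (i : Fin k) → x · unit i ≈ᴹ x i
  ·-unit x zero = begin
    x zero *ᵣ 1# +ᴹ Vector.tail x · (λ _ → 0#)
      ≈⟨ +ᴹ-cong (*ᵣ-identityʳ _) (·-zeroʳ (Vector.tail x) λ _ → refl) ⟩
    x zero +ᴹ 0ᴹ    ≈⟨ +ᴹ-identityʳ _ ⟩
    x zero          ∎
  ·-unit x (suc i) = begin
    x zero *ᵣ 0# +ᴹ Vector.tail x · unit i     ≈⟨ +ᴹ-cong (*ᵣ-zeroʳ _) (·-unit (Vector.tail x) i) ⟩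
    0ᴹ +ᴹ x (suc i)                     ≈⟨ +ᴹ-identityˡ _ ⟩
    x (suc i)                           ∎

  private module R = CommutativeRing R
  open Sum R.+-commutativeMonoid using () renaming (sum to sumᴿ)

  -- The sum on the right is the dot product of the ring as a module over itself. For a solution
  -- moved by z in the direction y, this computes the change in the value of a row.
  ·-*ˡ : (z : Carrierᴹ) (y r : Vector Carrier k) →
         (λ i → z *ᵣ y i) · r ≈ᴹ z *ᵣ sumᴿ (λ i → y i * r i)
  ·-*ˡ {zero}  z y r = ≈ᴹ-sym (*ᵣ-zeroʳ z)
  ·-*ˡ {suc k} z y r = ≈ᴹ-trans (+ᴹ-cong (*ᵣ-assoc z _ _) (·-*ˡ z (Vector.tail y) (Vector.tail r)))
                                (≈ᴹ-sym (*ᵣ-distribˡ z _ _))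

-- Divisibility and maximal ideals in a Bézout domain.

module BézoutDomain
  (em : ∀ {a} → ExcludedMiddle a)
  (zorn : ∀ {a ℓ₁ ℓ₂ p} → ZornsLemma a ℓ₁ ℓ₂ p)
  (B : IntegralDomain c ℓ)
  (bézout : IsBézout (IntegralDomain.commutativeRing B)) where

  open IntegralDomain B hiding (zero)
  open RawSemiringDefs (Semiring.rawSemiring semiring) using (_∣_; Coprime)
  open MonoidDivisibility *-monoid using (_,_; ∣ʳ-trans; ∣ʳ-refl; ∣ʳ-respʳ-≈; ∣ʳ-respˡ-≈)
  open RingProperties ring using (-1*x≈-x; -‿+-comm; x∙y⁻¹≈ε⇒x≈y; [y-z]x≈yx-zx; -‿distribʳ-*)
  open SetoidReasoning setoid
  open CommutativeSemiringSolver commutativeSemiring using (solve; _:=_; _:*_; _:+_)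
  open MaximalIdeals em zorn commutativeRing
  open Combination commutativeRing
  open DotProduct (TensorUnit.⟨module⟩ {R = commutativeRing})

  *-cancelʳ-nonzero : ∀ {x y z} → ¬ z ≈ 0# → x * z ≈ y * z → x ≈ y
  *-cancelʳ-nonzero {x} {y} {z} z≉0 eq = x∙y⁻¹≈ε⇒x≈y x y
    ([ id , (λ z≈0 → contradiction z≈0 z≉0) ]′ (noZeroDivisors (begin
      (x - y) * z      ≈⟨ [y-z]x≈yx-zx z x y ⟩
      x * z - y * z    ≈⟨ +-congʳ eq ⟩
      y * z - y * z    ≈⟨ -‿inverseʳ _ ⟩
      0#               ∎)))

  -- Repackages the divisibility record as a pair, to which `proj₁` and `proj₂` apply.
  quotient : ∀ {d x} → d ∣ x → ∃ λ q → q * d ≈ x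
  quotient (q , qd≈x) = q , qd≈x

  ∣-+ : ∀ {d x y} → d ∣ x → d ∣ y → d ∣ x + y
  ∣-+ (p , pd≈x) (q , qd≈y) = p + q , trans (distribʳ _ p q) (+-cong pd≈x qd≈y)

  ∣-*ˡ : ∀ {d x} r → d ∣ x → d ∣ r * x
  ∣-*ˡ r (p , pd≈x) = r * p , trans (*-assoc r p _) (*-congˡ pd≈x)

  ∣-*ʳ : ∀ {d x} r → d ∣ x → d ∣ x * r
  ∣-*ʳ r d∣x = ∣ʳ-respʳ-≈ (*-comm r _) (∣-*ˡ r d∣x)

  ∣-· : ∀ {d} (y r : Vector Carrier k) → (∀ i → d ∣ r i) → d ∣ y · r
  ∣-· {zero}  y r d∣r = 0# , zeroˡ _
  ∣-· {suc k} y r d∣r = ∣-+ (∣-*ˡ (y zero) (d∣r zero)) (∣-· (y ∘ suc) (r ∘ suc) (d∣r ∘ suc))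

  -- The Bézout generator of the ideal of the entries is itself some y · r, and it divides each
  -- entry because `unit i` exhibits `r i` as a member of the ideal. Thus y · r is the gcd of the
  -- entries, given with its coefficients.
  content : (r : Vector Carrier k) → ∃ λ y → ∀ i → y · r ∣ r i
  content r with bézout r
  ... | d , Gen⊆ , ⊆Gen with ⊆Gen ∣ʳ-refl
  ...   | y , d≈y·r = y , λ i →
          ∣ʳ-trans (1# , trans (*-identityˡ _) (sym d≈y·r)) (Gen⊆ (unit i , (begin
            r i          ≈⟨ ·-unit r i ⟨
            r · unit i   ≈⟨ ·-comm r (unit i) ⟩
            unit i · r   ∎)))
    where
    ·-comm : (x y : Vector Carrier k) → x · y ≈ y · x
    ·-comm {zero}  x y = refl
    ·-comm {suc k} x y = +-cong (*-comm _ _) (·-comm (x ∘ suc) (y ∘ suc))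

  bézout₂ : ∀ a b → ∃ λ p → ∃ λ q → p * a + q * b ∣ a × p * a + q * b ∣ b
  bézout₂ a b with content (a Vector.∷ b Vector.∷ Vector.[])
  ... | y , g∣ = y zero , y (suc zero) , ∣ʳ-trans g∣g′ (g∣ zero) , ∣ʳ-trans g∣g′ (g∣ (suc zero))
    where
    g∣g′ : y zero * a + y (suc zero) * b ∣ y · (a Vector.∷ b Vector.∷ Vector.[])
    g∣g′ = 1# , trans (*-identityˡ _) (+-congˡ (sym (+-identityʳ _)))

  principal : Carrier → Ideal commutativeRing
  principal d = record
    { member   = d ∣_
    ; respects = ∣ʳ-respʳ-≈
    ; 0∈       = 0# , zeroˡ d
    ; +-closed = ∣-+
    ; *-closed = λ r → ∣-*ˡ r
    }

  module _ (𝓜 : MSpec commutativeRing) where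
    open MSpec 𝓜

    ∣⇒∈ : ∀ {x y} → x ∣ y → x ∈ member → y ∈ member
    ∣⇒∈ (q , qx≈y) x∈ = respects qx≈y (*-closed q x∈)

    ·-∈ : (y r : Vector Carrier k) → (∀ i → r i ∈ member) → y · r ∈ member
    ·-∈ {zero}  y r r∈ = 0∈
    ·-∈ {suc k} y r r∈ = +-closed (*-closed _ (r∈ zero)) (·-∈ (y ∘ suc) (r ∘ suc) (r∈ ∘ suc))

    -‿∈ : ∀ {x} → x ∈ member → - x ∈ member
    -‿∈ {x} x∈ = respects (-1*x≈-x x) (*-closed (- 1#) x∈)

    ∈-cancelˡ : ∀ {x y} → x + y ∈ member → x ∈ member → y ∈ member
    ∈-cancelˡ {x} {y} x+y∈ x∈ = respects (begin
      - x + (x + y) ≈⟨ +-assoc _ _ _ ⟨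
      - x + x + y   ≈⟨ +-congʳ (-‿inverseˡ x) ⟩
      0# + y        ≈⟨ +-identityˡ y ⟩
      y             ∎) (+-closed (-‿∈ x∈) x+y∈)

    -- The Bézout combination of x and y is a common divisor, hence a unit by coprimality; a maximal
    -- ideal containing both would contain this unit.
    coprime⇒∉ : ∀ {x y} → Coprime x y → x ∈ member → y ∉ member
    coprime⇒∉ {x} {y} coprime x∈ y∈ with bézout₂ x y
    ... | p , q , g∣x , g∣y = proj₁ isMaximal
      (∣⇒∈ (coprime g∣x g∣y) (+-closed (*-closed p x∈) (*-closed q y∈)))

    prime : ∀ {x y} → x * y ∈ member → x ∉ member → y ∈ member
    prime xy∈ x∉ = decidable-stable em λ y∉ → maximal⇒prime B 𝓜 x∉ y∉ xy∈

  -- If the content of r is not a unit, it generates a proper ideal; a maximal ideal above it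
  -- contains every entry of r.
  unimodular : (r : Vector Carrier k) →
               (∀ (𝓜 : MSpec commutativeRing) → ¬ (∀ i → r i ∈ MSpec.member 𝓜)) →
               ∃ λ y → y · r ≈ 1#
  unimodular r r⊈ with content r
  ... | y , d∣r with em {P = y · r ∣ 1#}
  ...   | yes (q , qd≈1) = (λ i → q * y i) , trans (·-*ˡ q y r) qd≈1
  ...   | no d∤1 with proper⇒⊆maximal (principal (y · r)) d∤1
  ...     | 𝓜 , d⊆𝓜 = contradiction (λ i → d⊆𝓜 (d∣r i)) (r⊈ 𝓜)

  -- Unimodular combinations of two rows.

  module _ (goodFactorization : HasGoodFactorization commutativeRing) where

    -- The matrix with rows (α, β) and (γ, δ) has determinant 1, stated without subtraction, and its
    -- first row combines r and s into a unimodular row.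
    UnimodularCombination : (r s : Vector Carrier k) → Set _
    UnimodularCombination r s = ∃ λ α → ∃ λ β → ∃ λ γ → ∃ λ δ → α * δ ≈ 1# + β * γ ×
      ∃ λ y → y · combination r s α β ≈ 1#

    -- Three cases: r = 0; some 2 × 2 minor of r, s is nonzero, where good factorization enters; or
    -- all minors vanish and both rows are multiples of a single row.
    unimodularCombination : (r s z w : Vector Carrier k) → z · r + w · s ≈ 1# →
                            UnimodularCombination r s
    unimodularCombination r s z w zr+ws≈1 with content r
    ... | x , a∣r with em {P = x · r ≈ 0#}
    -- The content of r vanishes, so r = 0 and s is already unimodular. The matrix with rows (0, 1)
    -- and (-1, 0) brings s to the front.
    ...   | yes a≈0 = 0# , 1# , - 1# , 0# ,
            (begin
              0# * 0#             ≈⟨ zeroˡ 0# ⟩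
              0#                  ≈⟨ -‿inverseʳ 1# ⟨
              1# - 1#             ≈⟨ +-congˡ (*-identityˡ _) ⟨
              1# + 1# * - 1#      ∎) ,
            w , (begin
              w · combination r s 0# 1#     ≈⟨ ·-combination w r s 0# 1# ⟩
              w · r * 0# + w · s * 1#       ≈⟨ +-cong (zeroʳ _) (*-identityʳ _) ⟩
              0# + w · s                    ≈⟨ +-congʳ (·-zeroʳ z (λ i → r≈0 i)) ⟨
              z · r + w · s                 ≈⟨ zr+ws≈1 ⟩
              1#                            ∎)
      where
      r≈0 : ∀ i → r i ≈ 0#
      r≈0 i with a∣r i
      ... | q , qa≈r = trans (sym qa≈r) (trans (*-congˡ a≈0) (zeroʳ q))
    ...   | no a≉0 with em {P = ∃ λ i → ∃ λ j → ¬ r i * s j ≈ r j * s i}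
    ...     | yes (i , j , minor≉0) = generic (goodFactorization μ≉0 a≉0)
      where
      a = x · r
      μ = r i * s j - r j * s i
      μ≉0 : ¬ μ ≈ 0#
      μ≉0 μ≈0 = minor≉0 (x∙y⁻¹≈ε⇒x≈y _ _ μ≈0)

      generic : (∃ λ q → ∃ λ d → μ ≈ q * d × Coprime q a × a ∈ rad commutativeRing d) →
                UnimodularCombination r s
      -- The new row r + q s comes from the matrix with rows (1, q) and (0, 1).
      generic (q , d , μ≈qd , q⊥a , a∈rad-d) = 1# , q , 0# , 1# ,
        trans (*-identityˡ 1#) (sym (trans (+-congˡ (zeroʳ q)) (+-identityʳ 1#))) ,
        unimodular ρ absurd
        where
        ρ = combination r s 1# q

        ρ≈ : ∀ i → ρ i ≈ r i + s i * q
        ρ≈ i = +-congʳ (*-identityʳ (r i))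

        -- Adding a multiple of s to r does not change a minor with s. Hence μ lies in every maximal
        -- ideal that contains the entries of ρ.
        minor : ρ i * s j - ρ j * s i ≈ μ
        minor = begin
          ρ i * s j - ρ j * s i
            ≈⟨ +-cong (trans (*-congʳ (ρ≈ i)) (distribʳ _ _ _))
                 (-‿cong (trans (*-congʳ (ρ≈ j)) (trans (distribʳ _ _ _) (+-congˡ
                   (solve 3 (λ x y z → x :* y :* z := z :* y :* x) refl (s j) q (s i)))))) ⟩
          (X + Z) - (Y + Z)           ≈⟨ +-congˡ (-‿+-comm Y Z) ⟨
          (X + Z) + (- Y + - Z)
            ≈⟨ solve 4 (λ x z y v → (x :+ z) :+ (y :+ v) := (x :+ y) :+ (z :+ v))
                 refl X Z (- Y) (- Z) ⟩
          (X - Y) + (Z - Z)           ≈⟨ +-congˡ (-‿inverseʳ Z) ⟩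
          (X - Y) + 0#                ≈⟨ +-identityʳ _ ⟩
          μ                           ∎
          where
          X = r i * s j
          Y = r j * s i
          Z = s i * q * s j

        absurd : (𝓜 : MSpec commutativeRing) → ¬ (∀ i → ρ i ∈ MSpec.member 𝓜)
        absurd 𝓜 ρ∈ with em {P = q ∈ MSpec.member 𝓜}
        ... | yes q∈ = coprime⇒∉ 𝓜 q⊥a q∈ (·-∈ 𝓜 x r λ i →
              ∈-cancelˡ 𝓜 (respects (trans (ρ≈ i) (+-comm _ _)) (ρ∈ i)) (*-closed (s i) q∈))
          where open MSpec 𝓜
        ... | no q∉ = proj₁ isMaximal (respects zr+ws≈1 (+-closed (·-∈ 𝓜 z r r∈) (·-∈ 𝓜 w s s∈)))
          where
          open MSpec 𝓜
          μ∈ : μ ∈ member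
          μ∈ = respects minor (+-closed
            (respects (*-comm _ _) (*-closed (s j) (ρ∈ i)))
            (-‿∈ 𝓜 (respects (*-comm _ _) (*-closed (s i) (ρ∈ j)))))
          a∈ : a ∈ member
          a∈ = a∈rad-d 𝓜 (prime 𝓜 (respects μ≈qd μ∈) q∉)
          r∈ : ∀ i → r i ∈ member
          r∈ i = ∣⇒∈ 𝓜 (a∣r i) a∈
          s∈ : ∀ i → s i ∈ member
          s∈ i = prime 𝓜 (respects (*-comm _ _) (∈-cancelˡ 𝓜 (respects (ρ≈ i) (ρ∈ i)) (r∈ i))) q∉
    ...     | no minors≈0 = proportional (bézout₂ a b)
      where
      a = x · r
      b = x · s

      minor≈0 : ∀ i j → r i * s j ≈ r j * s i
      minor≈0 i j = decidable-stable em λ minor≉0 → minors≈0 (i , j , minor≉0)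

      -- The vanishing minors in column j, combined with the coefficients x, give proportionality of
      -- the rows with the factors a = x · r and b = x · s.
      as≈br : ∀ j → a * s j ≈ b * r j
      as≈br j = begin
        x · r * s j               ≈⟨ ·-*ʳ x r (s j) ⟨
        x · (λ i → r i * s j)     ≈⟨ ·-cong {x = x} (λ _ → refl)
                                       (λ i → trans (minor≈0 i j) (*-comm _ _)) ⟩
        x · (λ i → s i * r j)     ≈⟨ ·-*ʳ x s (r j) ⟩
        x · s * r j               ∎

      -- Let g = p a + q b be the gcd of a = a′ g and b = b′ g, and ρ = p r + q s. Then r = ρ a′ and
      -- s = ρ b′, so z · r + w · s = 1 turns into a combination of ρ alone. The second matrix row
      -- (-b′, a′) gives determinant p a′ + q b′, which is 1 after cancelling g.
      proportional : (∃ λ p → ∃ λ q → p * a + q * b ∣ a × p * a + q * b ∣ b) →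
                     UnimodularCombination r s
      proportional (p , q , (a′ , a′g≈a) , (b′ , b′g≈b)) = p , q , - b′ , a′ ,
        (begin
          p * a′                                     ≈⟨ +-identityʳ _ ⟨
          p * a′ + 0#                                ≈⟨ +-congˡ (-‿inverseʳ (q * b′)) ⟨
          p * a′ + (q * b′ - q * b′)                 ≈⟨ +-assoc _ _ _ ⟨
          p * a′ + q * b′ - q * b′                   ≈⟨ +-cong pa′+qb′≈1 (-‿distribʳ-* q b′) ⟩
          1# + q * - b′                              ∎) ,
        (λ i → a′ * z i + b′ * w i) , (begin
          (λ i → a′ * z i + b′ * w i) · ρ       ≈⟨ ·-distribʳ (λ i → a′ * z i) (λ i → b′ * w i) ρ ⟩
          (λ i → a′ * z i) · ρ + (λ i → b′ * w i) · ρ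
            ≈⟨ +-cong (scaled a′ z r ρa′≈r) (scaled b′ w s ρb′≈s) ⟩
          z · r + w · s                        ≈⟨ zr+ws≈1 ⟩
          1#                                   ∎)
        where
        g = p * a + q * b
        ρ = combination r s p q

        g≉0 : ¬ g ≈ 0#
        g≉0 g≈0 = a≉0 (trans (sym a′g≈a) (trans (*-congˡ g≈0) (zeroʳ a′)))

        pa′+qb′≈1 : p * a′ + q * b′ ≈ 1#
        pa′+qb′≈1 = *-cancelʳ-nonzero g≉0 (begin
          (p * a′ + q * b′) * g
            ≈⟨ solve 5 (λ p a q b g → (p :* a :+ q :* b) :* g := p :* (a :* g) :+ q :* (b :* g))
                 refl p a′ q b′ g ⟩
          p * (a′ * g) + q * (b′ * g)   ≈⟨ +-cong (*-congˡ a′g≈a) (*-congˡ b′g≈b) ⟩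
          g                             ≈⟨ *-identityˡ g ⟨
          1# * g                        ∎)

        -- By a s = b r, the product a (p r + q s) becomes (p a + q b) r.
        ρa≈rg : ∀ i → ρ i * a ≈ r i * g
        ρa≈rg i = begin
          (r i * p + s i * q) * a
            ≈⟨ solve 5 (λ r p s q a → (r :* p :+ s :* q) :* a := r :* (p :* a) :+ q :* (a :* s))
                 refl (r i) p (s i) q a ⟩
          r i * (p * a) + q * (a * s i)     ≈⟨ +-congˡ (*-congˡ (as≈br i)) ⟩
          r i * (p * a) + q * (b * r i)
            ≈⟨ solve 5 (λ r p a q b → r :* (p :* a) :+ q :* (b :* r) := r :* (p :* a :+ q :* b))
                 refl (r i) p a q b ⟩
          r i * g                           ∎

        ρa′≈r : ∀ i → ρ i * a′ ≈ r i
        ρa′≈r i = *-cancelʳ-nonzero g≉0 (trans (*-assoc _ _ _) (trans (*-congˡ a′g≈a) (ρa≈rg i)))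

        ρb′≈s : ∀ i → ρ i * b′ ≈ s i
        ρb′≈s i = *-cancelʳ-nonzero a≉0 (begin
          ρ i * b′ * a        ≈⟨ solve 3 (λ ρ b a → ρ :* b :* a := ρ :* a :* b) refl (ρ i) b′ a ⟩
          ρ i * a * b′        ≈⟨ *-congʳ (ρa≈rg i) ⟩
          r i * g * b′        ≈⟨ solve 3 (λ r g b → r :* g :* b := b :* g :* r) refl (r i) g b′ ⟩
          b′ * g * r i        ≈⟨ *-congʳ b′g≈b ⟩
          b * r i             ≈⟨ as≈br i ⟨
          a * s i             ≈⟨ *-comm _ _ ⟩
          s i * a             ∎)

        scaled : ∀ t (y v : Vector Carrier _) → (∀ i → ρ i * t ≈ v i) → (λ i → t * y i) · ρ ≈ y · v
        scaled t y v ρt≈v = begin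
          (λ i → t * y i) · ρ          ≈⟨ ·-*ˡ t y ρ ⟩
          t * (y · ρ)                  ≈⟨ *-comm _ _ ⟩
          y · ρ * t                    ≈⟨ ·-*ʳ y ρ t ⟨
          y · (λ i → ρ i * t)          ≈⟨ ·-cong {x = y} (λ _ → refl) ρt≈v ⟩
          y · v                        ∎

    -- Divide both rows by the gcd g of all their entries, make a unimodular combination of the
    -- quotients, and multiply back: g is then a combination of the entries of a single row.
    contentCombination : (r s : Vector Carrier k) →
      ∃ λ α → ∃ λ β → ∃ λ γ → ∃ λ δ → α * δ ≈ 1# + β * γ × ∃ λ y →
        (∀ i → y · combination r s α β ∣ r i) × (∀ i → y · combination r s α β ∣ s i)
    contentCombination r s with content r | content s
    ... | y , d∣r | w , e∣s with bézout₂ (y · r) (w · s)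
    ...   | p , q , g∣d , g∣e with em {P = p * (y · r) + q * (w · s) ≈ 0#}
    -- All entries are multiples of g = 0, hence zero and divisible by anything; the identity matrix
    -- and y = 0 serve.
    ...     | yes g≈0 = 1# , 0# , 0# , 1# ,
              trans (*-identityˡ 1#) (sym (trans (+-congˡ (zeroʳ 0#)) (+-identityʳ 1#))) ,
              (λ _ → 0#) ,
              (λ i → ∣-of-zero _ (∣ʳ-trans g∣d (d∣r i))) ,
              (λ i → ∣-of-zero _ (∣ʳ-trans g∣e (e∣s i)))
      where
      ∣-of-zero : ∀ d {x} → p * (y · r) + q * (w · s) ∣ x → d ∣ x
      ∣-of-zero d (t , tg≈x) = 0# ,
        trans (zeroˡ d) (trans (sym (trans (*-congˡ g≈0) (zeroʳ t))) tg≈x)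
    -- The quotient rows generate the unit ideal: with coefficients p y and q w their combination
    -- becomes g after multiplication by g, and g cancels.
    ...     | no g≉0 = divided (unimodularCombination r′ s′ (λ i → p * y i) (λ i → q * w i)
              (*-cancelʳ-nonzero g≉0 (begin
                ((λ i → p * y i) · r′ + (λ i → q * w i) · s′) * g     ≈⟨ distribʳ g _ _ ⟩
                (λ i → p * y i) · r′ * g + (λ i → q * w i) · s′ * g
                  ≈⟨ +-cong (unscale p y r r′ r′g≈r) (unscale q w s s′ s′g≈s) ⟩
                g                                                     ≈⟨ *-identityˡ g ⟨
                1# * g                                                ∎)))
      where
      g = p * (y · r) + q * (w · s)
      g∣r : ∀ i → g ∣ r i
      g∣r i = ∣ʳ-trans g∣d (d∣r i)
      g∣s : ∀ i → g ∣ s i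
      g∣s i = ∣ʳ-trans g∣e (e∣s i)
      r′ s′ : Vector Carrier _
      r′ i = proj₁ (quotient (g∣r i))
      s′ i = proj₁ (quotient (g∣s i))
      r′g≈r : ∀ i → r′ i * g ≈ r i
      r′g≈r i = proj₂ (quotient (g∣r i))
      s′g≈s : ∀ i → s′ i * g ≈ s i
      s′g≈s i = proj₂ (quotient (g∣s i))

      unscale : ∀ t (x v v′ : Vector Carrier _) → (∀ i → v′ i * g ≈ v i) →
                (λ i → t * x i) · v′ * g ≈ t * (x · v)
      unscale t x v v′ v′g≈v = begin
        (λ i → t * x i) · v′ * g          ≈⟨ ·-*ʳ (λ i → t * x i) v′ g ⟨
        (λ i → t * x i) · (λ i → v′ i * g) ≈⟨ ·-*ˡ t x (λ i → v′ i * g) ⟩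
        t * (x · (λ i → v′ i * g))        ≈⟨ *-congˡ (·-cong {x = x} (λ _ → refl) v′g≈v) ⟩
        t * (x · v)                       ∎

      divided : UnimodularCombination r′ s′ → _
      divided (α , β , γ , δ , det , x , xρ′≈1) = α , β , γ , δ , det , x ,
        (λ i → ∣ʳ-respˡ-≈ g≈xρ (g∣r i)) , (λ i → ∣ʳ-respˡ-≈ g≈xρ (g∣s i))
        where
        g≈xρ : g ≈ x · combination r s α β
        g≈xρ = begin
          g                                           ≈⟨ *-identityˡ g ⟨
          1# * g                                      ≈⟨ *-congʳ xρ′≈1 ⟨
          x · combination r′ s′ α β * g               ≈⟨ ·-*ʳ x (combination r′ s′ α β) g ⟨
          x · (λ i → combination r′ s′ α β i * g)     ≈⟨ ·-cong {x = x} (λ _ → refl) (λ i → trans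
            (solve 5 (λ r α s β g → (r :* α :+ s :* β) :* g := r :* g :* α :+ s :* g :* β)
              refl (r′ i) α (s′ i) β g)
            (+-cong (*-congʳ (r′g≈r i)) (*-congʳ (s′g≈s i)))) ⟩
          x · combination r s α β                     ∎

-- Divisibility conditions.

module Conditions (B : IntegralDomain c ℓ) (M : ValuedModule B m ℓm ℓv) where
  open IntegralDomain B using (Carrier)
  open ValuedModule M

  ⟦_⟧ᴹ : Term Carrier n → Vector Carrierᴹ n → Carrierᴹ
  ⟦ t ⟧ᴹ = ⟦_⟧ (valuedStructure B M) t

  -- `(a , t)` stands for a ∣ t. The case a = 0 expresses the equation t = 0.
  Condition : ℕ → Set c
  Condition n = Carrier × Term Carrier n

  Divisible : Vector Carrierᴹ n → Condition n → Set (m ⊔ ℓm)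
  Divisible u (a , t) = ∃ λ z → z *ᵣ a ≈ᴹ ⟦ t ⟧ᴹ u

-- Elimination in linear systems with unknowns in M.

module LinearSystems
  (em : ∀ {a} → ExcludedMiddle a)
  (zorn : ∀ {a ℓ₁ ℓ₂ p} → ZornsLemma a ℓ₁ ℓ₂ p)
  (B : IntegralDomain c ℓ)
  (bézout : IsBézout (IntegralDomain.commutativeRing B))
  (goodFactorization : HasGoodFactorization (IntegralDomain.commutativeRing B))
  (M : ValuedModule B m ℓm ℓv) where

  open IntegralDomain B hiding (zero; _-_)
  open RawSemiringDefs (Semiring.rawSemiring semiring) using (_∣_)
  open MonoidDivisibility *-monoid using (_,_; ∣ʳ-trans)
  open ValuedModule M
  open AbelianGroupProperties +ᴹ-abelianGroup
    using (∙-cancelʳ; inverseˡ-unique; ⁻¹-∙-comm; xyx⁻¹≈y; x≈y⇒x∙y⁻¹≈ε; x∙y⁻¹≈ε⇒x≈y)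
  open CommutativeSemigroupProperties (CommutativeMonoid.commutativeSemigroup +ᴹ-commutativeMonoid)
    using (interchange)
  open SetoidReasoning ≈ᴹ-setoid
  open BézoutDomain em zorn B bézout
  open Combination commutativeRing
  open DotProduct baseModule
  open Conditions B M
  private module 𝐵 = DotProduct (TensorUnit.⟨module⟩ {R = commutativeRing})
  open 𝐵 using () renaming (_·_ to _·ᴮ_)

  Row : ℕ → ℕ → Set c
  Row k n = Vector Carrier k × Term Carrier n

  Holds : Vector Carrierᴹ n → Vector Carrierᴹ k → Row k n → Set ℓm
  Holds u x (r , t) = x · r ≈ᴹ ⟦ t ⟧ᴹ u

  combine : Row k n → Row k n → Carrier → Carrier → Row k n
  combine (r , t) (s , t′) α β = combination r s α β , (t ⊙ α) ⊕ (t′ ⊙ β)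

  combine-holds : ∀ {u : Vector Carrierᴹ n} {x : Vector Carrierᴹ k} (R S : Row k n) α β →
                  Holds u x R → Holds u x S → Holds u x (combine R S α β)
  combine-holds {x = x} (r , t) (s , t′) α β x·r≈t x·s≈t′ = ≈ᴹ-trans (·-combination x r s α β)
    (+ᴹ-cong (*ᵣ-congʳ x·r≈t) (*ᵣ-congʳ x·s≈t′))

  *ᵣ-neg : ∀ x → x *ᵣ - 1# ≈ᴹ -ᴹ x
  *ᵣ-neg x = inverseˡ-unique _ _ (begin
    x *ᵣ - 1# +ᴹ x          ≈⟨ +ᴹ-cong ≈ᴹ-refl (*ᵣ-identityʳ x) ⟨
    x *ᵣ - 1# +ᴹ x *ᵣ 1#    ≈⟨ *ᵣ-distribˡ x (- 1#) 1# ⟨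
    x *ᵣ (- 1# + 1#)        ≈⟨ *ᵣ-congˡ (-‿inverseˡ 1#) ⟩
    x *ᵣ 0#                 ≈⟨ *ᵣ-zeroʳ x ⟩
    0ᴹ                      ∎)

  -- Cramer's rule without subtraction: by αδ = 1 + βγ, the first combination times δ equals w plus
  -- the second combination times β, so both combinations determine w.
  det₁-injective : ∀ {α β γ δ w x y z} → α * δ ≈ 1# + β * γ →
    w *ᵣ α +ᴹ x *ᵣ β ≈ᴹ y *ᵣ α +ᴹ z *ᵣ β →
    w *ᵣ γ +ᴹ x *ᵣ δ ≈ᴹ y *ᵣ γ +ᴹ z *ᵣ δ → w ≈ᴹ y
  det₁-injective {α} {β} {γ} {δ} {w} {x} {y} {z} det eq eq′ = ∙-cancelʳ _ _ _ (begin
    w +ᴹ (w *ᵣ γ +ᴹ x *ᵣ δ) *ᵣ β      ≈⟨ expand w x ⟩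
    (w *ᵣ α +ᴹ x *ᵣ β) *ᵣ δ           ≈⟨ *ᵣ-congʳ eq ⟩
    (y *ᵣ α +ᴹ z *ᵣ β) *ᵣ δ           ≈⟨ expand y z ⟨
    y +ᴹ (y *ᵣ γ +ᴹ z *ᵣ δ) *ᵣ β      ≈⟨ +ᴹ-cong ≈ᴹ-refl (*ᵣ-congʳ eq′) ⟨
    y +ᴹ (w *ᵣ γ +ᴹ x *ᵣ δ) *ᵣ β      ∎)
    where
    distribute : ∀ {p q a b d} → (p *ᵣ a +ᴹ q *ᵣ b) *ᵣ d ≈ᴹ p *ᵣ (a * d) +ᴹ q *ᵣ (b * d)
    distribute = ≈ᴹ-trans (*ᵣ-distribʳ _ _ _) (+ᴹ-cong (*ᵣ-assoc _ _ _) (*ᵣ-assoc _ _ _))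
    expand : ∀ p q → p +ᴹ (p *ᵣ γ +ᴹ q *ᵣ δ) *ᵣ β ≈ᴹ (p *ᵣ α +ᴹ q *ᵣ β) *ᵣ δ
    expand p q = begin
      p +ᴹ (p *ᵣ γ +ᴹ q *ᵣ δ) *ᵣ β                ≈⟨ +ᴹ-cong (≈ᴹ-sym (*ᵣ-identityʳ p)) distribute ⟩
      p *ᵣ 1# +ᴹ (p *ᵣ (γ * β) +ᴹ q *ᵣ (δ * β))   ≈⟨ +ᴹ-assoc _ _ _ ⟨
      p *ᵣ 1# +ᴹ p *ᵣ (γ * β) +ᴹ q *ᵣ (δ * β)     ≈⟨ +ᴹ-cong (*ᵣ-distribˡ p 1# (γ * β)) ≈ᴹ-refl ⟨
      p *ᵣ (1# + γ * β) +ᴹ q *ᵣ (δ * β)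
        ≈⟨ +ᴹ-cong (*ᵣ-congˡ (trans (+-congˡ (*-comm γ β)) (sym det))) (*ᵣ-congˡ (*-comm δ β)) ⟩
      p *ᵣ (α * δ) +ᴹ q *ᵣ (β * δ)                ≈⟨ distribute ⟨
      (p *ᵣ α +ᴹ q *ᵣ β) *ᵣ δ                     ∎

  combine-invertible : ∀ {α β γ δ} → α * δ ≈ 1# + β * γ → (R S : Row k n) →
    ∀ {u x} → (Holds u x R × Holds u x S) ⇔
              (Holds u x (combine R S α β) × Holds u x (combine R S γ δ))
  combine-invertible {α = α} {β} {γ} {δ} det R@(r , t) S@(s , t′) {u} {x} = mk⇔
    (λ (hR , hS) → combine-holds R S α β hR hS , combine-holds R S γ δ hR hS)
    (λ (h , h′) →
      let eq  = ≈ᴹ-trans (≈ᴹ-sym (·-combination x r s α β)) h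
          eq′ = ≈ᴹ-trans (≈ᴹ-sym (·-combination x r s γ δ)) h′
      in det₁-injective det eq eq′ ,
         -- The second unknown is recovered by the same rule after exchanging the two unknowns and
         -- the two equations, that is, α with δ and β with γ.
         det₁-injective (trans (*-comm δ α) (trans det (+-congˡ (*-comm β γ))))
           (swap eq′) (swap eq))
    where
    swap : ∀ {p q p′ q′} → p +ᴹ q ≈ᴹ p′ +ᴹ q′ → q +ᴹ p ≈ᴹ q′ +ᴹ p′
    swap eq = ≈ᴹ-trans (+ᴹ-comm _ _) (≈ᴹ-trans eq (+ᴹ-comm _ _))

  _divides_ : Carrier → Row k n → Set (c ⊔ ℓ)
  d divides (r , _) = ∀ i → d ∣ r i

  -- `contentCombination` is folded through the list: of each pair of rows, the combination carrying
  -- the gcd goes on and the other one stays behind. The clause `d divides R` carries the induction: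
  -- applied to the combined row it makes d divide that row's gcd, hence both rows combined.
  gather : ∀ {N} (R : Row k n) (Rs : Vec (Row k n) N) →
    ∃ λ S → ∃ λ (Ss : Vec (Row k n) N) → ∃ λ y → let d = y ·ᴮ proj₁ S in
      d divides R × d divides S × Allⱽ (d divides_) Ss ×
      (∀ {u x} → (Holds u x R × Allⱽ (Holds u x) Rs) ⇔ (Holds u x S × Allⱽ (Holds u x) Ss))
  gather R [] with content (proj₁ R)
  ... | y , d∣R = R , [] , y , d∣R , d∣R , [] , mk⇔ id id
  gather R (R′ ∷ Rs) with contentCombination goodFactorization (proj₁ R) (proj₁ R′)
  ... | α , β , γ , δ , det , w , e∣R , e∣R′ with gather (combine R R′ α β) Rs
  ...   | S , Ss , y , d∣ρ , d∣S , d∣Ss , equiv =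
    S , combine R R′ γ δ ∷ Ss , y ,
    (λ i → ∣ʳ-trans d∣e (e∣R i)) , d∣S ,
    (λ i → ∣-+ (∣-*ʳ γ (∣ʳ-trans d∣e (e∣R i))) (∣-*ʳ δ (∣ʳ-trans d∣e (e∣R′ i)))) ∷ d∣Ss ,
    mk⇔
      (λ { (hR , hR′ ∷ hRs) →
        let (hρ , hσ) = Equivalence.to (combine-invertible det R R′) (hR , hR′)
            (hS , hSs) = Equivalence.to equiv (hρ , hRs)
        in hS , hσ ∷ hSs })
      (λ { (hS , hσ ∷ hSs) →
        let (hρ , hRs) = Equivalence.from equiv (hS , hSs)
            (hR , hR′) = Equivalence.from (combine-invertible det R R′) (hρ , hσ)
        in hR , hR′ ∷ hRs })
    where
    d∣e = ∣-· w (proj₁ (combine R R′ α β)) d∣ρ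

  -- With y · r′ = e d for the coefficients r′ of a row, subtracting e times `R` makes the row
  -- orthogonal to y, though its single entries may stay nonzero. While `R` holds, this step can be
  -- undone.
  clear : ∀ {N} (R : Row k n) (y : Vector Carrier k) (Rs : Vec (Row k n) N) →
    Allⱽ ((y ·ᴮ proj₁ R) divides_) Rs →
    ∃ λ (Ss : Vec (Row k n) N) → Allⱽ (λ S → y ·ᴮ proj₁ S ≈ 0#) Ss ×
      (∀ {u x} → Holds u x R → Allⱽ (Holds u x) Rs ⇔ Allⱽ (Holds u x) Ss)
  clear R y [] [] = [] , [] , λ _ → mk⇔ id id
  clear R y (R′ ∷ Rs) (d∣R′ ∷ d∣Rs) with clear R y Rs d∣Rs | quotient (∣-· y (proj₁ R′) d∣R′)
  ... | Ss , y·Ss≈0 , equiv | e , ed≈y·R′ = combine R′ R 1# (- e) ∷ Ss , y·S≈0 ∷ y·Ss≈0 ,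
    λ hR → mk⇔
      (λ { (hR′ ∷ hRs) → combine-holds R′ R 1# (- e) hR′ hR ∷ Equivalence.to (equiv hR) hRs })
      (λ { (hS ∷ hSs) → recover hR hS ∷ Equivalence.from (equiv hR) hSs })
    where
    d = y ·ᴮ proj₁ R
    y·S≈0 : y ·ᴮ combination (proj₁ R′) (proj₁ R) 1# (- e) ≈ 0#
    y·S≈0 = trans (𝐵.·-combination y (proj₁ R′) (proj₁ R) 1# (- e))
      (trans (+-cong (trans (*-identityʳ _) (trans (sym ed≈y·R′) (*-comm e d))) refl)
        (trans (sym (distribˡ d e (- e))) (trans (*-congˡ (-‿inverseʳ e)) (zeroʳ d))))
    recover : ∀ {u x} → Holds u x R → Holds u x (combine R′ R 1# (- e)) → Holds u x R′
    recover {u} {x} hR hS = begin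
      x · proj₁ R′                  ≈⟨ *ᵣ-identityʳ _ ⟨
      (x · proj₁ R′) *ᵣ 1#          ≈⟨ ∙-cancelʳ _ _ _ (begin
        (x · proj₁ R′) *ᵣ 1# +ᴹ (x · proj₁ R) *ᵣ - e
                                    ≈⟨ ·-combination x (proj₁ R′) (proj₁ R) 1# (- e) ⟨
        x · combination (proj₁ R′) (proj₁ R) 1# (- e)
                                    ≈⟨ hS ⟩
        ⟦ proj₂ R′ ⟧ᴹ u *ᵣ 1# +ᴹ ⟦ proj₂ R ⟧ᴹ u *ᵣ - e
                                    ≈⟨ +ᴹ-cong ≈ᴹ-refl (*ᵣ-congʳ hR) ⟨
        ⟦ proj₂ R′ ⟧ᴹ u *ᵣ 1# +ᴹ (x · proj₁ R) *ᵣ - e  ∎) ⟩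
      ⟦ proj₂ R′ ⟧ᴹ u *ᵣ 1#         ≈⟨ *ᵣ-identityʳ _ ⟩
      ⟦ proj₂ R′ ⟧ᴹ u               ∎

  Solvable : ∀ {N} → Vector Carrierᴹ n → Vec (Row k n) N → Set _
  Solvable u Rs = ∃ λ x → Allⱽ (Holds u x) Rs

  -- The row holding the gcd d yields the condition d ∣ t. The remaining rows are orthogonal to y,
  -- so a solution of them can be shifted along y until the first row holds as well.
  eliminate : ∀ {N} (Rs : Vec (Row k n) N) → ∃ λ (Cs : List (Condition n)) →
              ∀ u → Solvable u Rs ⇔ All (Divisible u) Cs
  eliminate [] = [] , λ u → mk⇔ (λ _ → []) (λ _ → (λ _ → 0ᴹ) , [])
  eliminate (R₀ ∷ Rs₀) with gather R₀ Rs₀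
  ... | R@(r , t) , Rs , y , _ , d∣R , d∣Rs , gathered with clear R y Rs d∣Rs
  -- The recursion descends on the implicit length: `Ss` is no subterm of the argument but has one
  -- row fewer.
  ...   | Ss , y·Ss≈0 , cleared with eliminate Ss
  ...     | Cs , solved = (d , t) ∷ Cs , λ u → mk⇔
      (λ { (x , hR₀ ∷ hRs₀) →
        let (hR , hRs) = Equivalence.to gathered (hR₀ , hRs₀)
        in (x · r′ , ≈ᴹ-trans (·-r x) hR) ∷
           Equivalence.to (solved u) (x , Equivalence.to (cleared hR) hRs) })
      (λ { ((z , zd≈t) ∷ hCs) →
        let (x , hSs) = Equivalence.from (solved u) hCs
            X = adjust x z
            hR = ≈ᴹ-trans (adjust-r x z) zd≈t
            (hR₀ , hRs₀) = Equivalence.from gathered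
              (hR , Equivalence.from (cleared hR) (kept x z y·Ss≈0 hSs))
        in X , hR₀ ∷ hRs₀ })
    where
    d = y ·ᴮ r
    r′ : Vector Carrier _
    r′ i = proj₁ (quotient (d∣R i))

    ·-r : ∀ x → (x · r′) *ᵣ d ≈ᴹ x · r
    ·-r x = ≈ᴹ-trans (≈ᴹ-sym (·-*ʳ x r′ d))
      (·-cong {x = x} (λ _ → ≈ᴹ-refl) λ i → proj₂ (quotient (d∣R i)))

    -- As y · r = d and x · r = (x · r′) d, this multiple of y changes the value of the first row
    -- from (x · r′) d to z d.
    adjust : Vector Carrierᴹ _ → Carrierᴹ → Vector Carrierᴹ _
    adjust x z i = x i +ᴹ (z +ᴹ -ᴹ (x · r′)) *ᵣ y i

    adjust-· : ∀ x z (s : Vector Carrier _) →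
               adjust x z · s ≈ᴹ x · s +ᴹ (z +ᴹ -ᴹ (x · r′)) *ᵣ (y ·ᴮ s)
    adjust-· x z s = ≈ᴹ-trans (·-distribʳ x (λ i → (z +ᴹ -ᴹ (x · r′)) *ᵣ y i) s)
      (+ᴹ-cong ≈ᴹ-refl (·-*ˡ (z +ᴹ -ᴹ (x · r′)) y s))

    adjust-r : ∀ x z → adjust x z · r ≈ᴹ z *ᵣ d
    adjust-r x z = begin
      adjust x z · r                                   ≈⟨ adjust-· x z r ⟩
      x · r +ᴹ (z +ᴹ -ᴹ (x · r′)) *ᵣ d                 ≈⟨ +ᴹ-cong (·-r x) ≈ᴹ-refl ⟨
      (x · r′) *ᵣ d +ᴹ (z +ᴹ -ᴹ (x · r′)) *ᵣ d         ≈⟨ *ᵣ-distribʳ d _ _ ⟨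
      (x · r′ +ᴹ (z +ᴹ -ᴹ (x · r′))) *ᵣ d              ≈⟨ *ᵣ-congʳ (begin
        x · r′ +ᴹ (z +ᴹ -ᴹ (x · r′))                     ≈⟨ +ᴹ-comm _ _ ⟩
        z +ᴹ -ᴹ (x · r′) +ᴹ x · r′                       ≈⟨ +ᴹ-assoc _ _ _ ⟩
        z +ᴹ (-ᴹ (x · r′) +ᴹ x · r′)                     ≈⟨ +ᴹ-cong ≈ᴹ-refl (-ᴹ‿inverseˡ _) ⟩
        z +ᴹ 0ᴹ                                          ≈⟨ +ᴹ-identityʳ z ⟩
        z                                                ∎) ⟩
      z *ᵣ d                                           ∎

    kept : ∀ {N u} {Ss : Vec (Row _ _) N} x z → Allⱽ (λ S → y ·ᴮ proj₁ S ≈ 0#) Ss →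
           Allⱽ (Holds u x) Ss → Allⱽ (Holds u (adjust x z)) Ss
    kept x z [] [] = []
    kept {Ss = (s , _) ∷ _} x z (y·s≈0 ∷ y·Ss≈0) (hS ∷ hSs) = (≈ᴹ-trans (begin
      adjust x z · s                                   ≈⟨ adjust-· x z s ⟩
      x · s +ᴹ (z +ᴹ -ᴹ (x · r′)) *ᵣ (y ·ᴮ s)
        ≈⟨ +ᴹ-cong ≈ᴹ-refl (≈ᴹ-trans (*ᵣ-congˡ y·s≈0) (*ᵣ-zeroʳ _)) ⟩
      x · s +ᴹ 0ᴹ                                      ≈⟨ +ᴹ-identityʳ _ ⟩
      x · s                                            ∎) hS) ∷ kept x z y·Ss≈0 hSs

  -- From pp formulas to linear systems.

  -- A term is linear, so it separates into coefficients of the k bound variables and a term in the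
  -- n free ones.
  split : ∀ n {k} → Term Carrier (n ℕ.+ k) → Vector Carrier k × Term Carrier n
  split n (var i)  = [ (λ j → (λ _ → 0#) , var j) , (λ j → unit j , 𝟎) ]′ (splitAt n i)
  split n 𝟎        = (λ _ → 0#) , 𝟎
  split n (t ⊕ t′) = (λ i → proj₁ (split n t) i + proj₁ (split n t′) i) ,
                     proj₂ (split n t) ⊕ proj₂ (split n t′)
  split n (⊖ t)    = (λ i → proj₁ (split n t) i * - 1#) , ⊖ proj₂ (split n t)
  split n (t ⊙ a)  = (λ i → proj₁ (split n t) i * a) , proj₂ (split n t) ⊙ a

  split-⟦⟧ : ∀ {n k} (t : Term Carrier (n ℕ.+ k)) (u : Vector Carrierᴹ n) (x : Vector Carrierᴹ k) →
             ⟦ t ⟧ᴹ (u ++ x) ≈ᴹ x · proj₁ (split n t) +ᴹ ⟦ proj₂ (split n t) ⟧ᴹ u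
  split-⟦⟧ {n} (var i) u x with splitAt n i
  ... | inj₁ j = ≈ᴹ-sym (≈ᴹ-trans (+ᴹ-cong (·-zeroʳ x λ _ → refl) ≈ᴹ-refl) (+ᴹ-identityˡ _))
  ... | inj₂ j = ≈ᴹ-sym (≈ᴹ-trans (+ᴹ-identityʳ _) (·-unit x j))
  split-⟦⟧ 𝟎 u x = ≈ᴹ-sym (≈ᴹ-trans (+ᴹ-identityʳ _) (·-zeroʳ x λ _ → refl))
  split-⟦⟧ {n} (t ⊕ t′) u x = begin
    ⟦ t ⟧ᴹ (u ++ x) +ᴹ ⟦ t′ ⟧ᴹ (u ++ x)    ≈⟨ +ᴹ-cong (split-⟦⟧ t u x) (split-⟦⟧ t′ u x) ⟩
    (x · r +ᴹ ⟦ s ⟧ᴹ u) +ᴹ (x · r′ +ᴹ ⟦ s′ ⟧ᴹ u)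
      ≈⟨ interchange _ _ _ _ ⟩
    (x · r +ᴹ x · r′) +ᴹ (⟦ s ⟧ᴹ u +ᴹ ⟦ s′ ⟧ᴹ u)
      ≈⟨ +ᴹ-cong (·-distribˡ x r r′) ≈ᴹ-refl ⟨
    x · (λ i → r i + r′ i) +ᴹ (⟦ s ⟧ᴹ u +ᴹ ⟦ s′ ⟧ᴹ u)   ∎
    where
    r = proj₁ (split n t)
    s = proj₂ (split n t)
    r′ = proj₁ (split n t′)
    s′ = proj₂ (split n t′)
  split-⟦⟧ {n} (⊖ t) u x = begin
    -ᴹ ⟦ t ⟧ᴹ (u ++ x)                        ≈⟨ -ᴹ‿cong (split-⟦⟧ t u x) ⟩
    -ᴹ (x · r +ᴹ ⟦ s ⟧ᴹ u)                    ≈⟨ ⁻¹-∙-comm _ _ ⟨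
    -ᴹ (x · r) +ᴹ -ᴹ ⟦ s ⟧ᴹ u
      ≈⟨ +ᴹ-cong (≈ᴹ-trans (·-*ʳ x r (- 1#)) (*ᵣ-neg _)) ≈ᴹ-refl ⟨
    x · (λ i → r i * - 1#) +ᴹ -ᴹ ⟦ s ⟧ᴹ u     ∎
    where
    r = proj₁ (split n t)
    s = proj₂ (split n t)
  split-⟦⟧ {n} (t ⊙ a) u x = begin
    ⟦ t ⟧ᴹ (u ++ x) *ᵣ a                      ≈⟨ *ᵣ-congʳ (split-⟦⟧ t u x) ⟩
    (x · r +ᴹ ⟦ s ⟧ᴹ u) *ᵣ a                  ≈⟨ *ᵣ-distribʳ a _ _ ⟩
    (x · r) *ᵣ a +ᴹ ⟦ s ⟧ᴹ u *ᵣ a             ≈⟨ +ᴹ-cong (·-*ʳ x r a) ≈ᴹ-refl ⟨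
    x · (λ i → r i * a) +ᴹ ⟦ s ⟧ᴹ u *ᵣ a      ∎
    where
    r = proj₁ (split n t)
    s = proj₂ (split n t)

  -- The N unknowns in front are the witnesses of divisibility; they get coefficient 0.
  pad : ∀ N {k} → Vector Carrier k → Vector Carrier (N ℕ.+ k)
  pad zero    r = r
  pad (suc N) r = 0# Vector.∷ pad N r

  weaken : Row k n → Row (suc k) n
  weaken (r , t) = 0# Vector.∷ r , t

  0∷-· : (x : Vector Carrierᴹ (suc k)) (r : Vector Carrier k) →
         x · (0# Vector.∷ r) ≈ᴹ Vector.tail x · r
  0∷-· x r = ≈ᴹ-trans (+ᴹ-cong (*ᵣ-zeroʳ _) ≈ᴹ-refl) (+ᴹ-identityˡ _)

  -- Each condition a ∣ t gets its own unknown z, in the equation z a − x · r = s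
  -- where t = x · r + s.
  rows : (Cs : List (Condition (n ℕ.+ k))) → Vec (Row (length Cs ℕ.+ k) n) (length Cs)
  rows [] = []
  rows {n} ((a , t) ∷ Cs) =
    (a Vector.∷ pad (length Cs) (λ i → proj₁ (split n t) i * - 1#) , proj₂ (split n t)) ∷
    Vec.map weaken (rows Cs)

  module _ (u : Vector Carrierᴹ n) where

    -- Says that x consists of the last k entries of x̂, expressed through dot products, which
    -- avoids index arithmetic in `Fin`.
    Extends : ∀ N → Vector Carrierᴹ (N ℕ.+ k) → Vector Carrierᴹ k → Set _
    Extends N x̂ x = ∀ r → x̂ · pad N r ≈ᴹ x · r

    weaken-holds : (x : Vector Carrierᴹ (suc k)) {Rs : Vec (Row k n) N} →
                   Allⱽ (Holds u (Vector.tail x)) Rs ⇔ Allⱽ (Holds u x) (Vec.map weaken Rs)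
    weaken-holds x = mk⇔
      (λ h → Allⱽ.map⁺ (Allⱽ.map (λ {(r , _)} → ≈ᴹ-trans (0∷-· x r)) h))
      (λ h → Allⱽ.map (λ {(r , _)} → ≈ᴹ-trans (≈ᴹ-sym (0∷-· x r))) (Allⱽ.map⁻ h))

    first-row : ∀ {N} a (t : Term Carrier (n ℕ.+ k)) (x̂ : Vector Carrierᴹ (suc N ℕ.+ k))
      (x : Vector Carrierᴹ k) →
      Extends N (Vector.tail x̂) x →
      (Vector.head x̂ *ᵣ a ≈ᴹ ⟦ t ⟧ᴹ (u ++ x)) ⇔
      Holds u x̂ (a Vector.∷ pad N (λ i → proj₁ (split n t) i * - 1#) , proj₂ (split n t))
    first-row {N = N} a t x̂ x ext = mk⇔
      (λ za≈t → begin
        x̂ · (a Vector.∷ pad N (λ i → r i * - 1#))   ≈⟨ row ⟩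
        z *ᵣ a +ᴹ -ᴹ (x · r)
          ≈⟨ +ᴹ-cong (≈ᴹ-trans za≈t (split-⟦⟧ t u x)) ≈ᴹ-refl ⟩
        x · r +ᴹ ⟦ s ⟧ᴹ u +ᴹ -ᴹ (x · r)             ≈⟨ xyx⁻¹≈y _ _ ⟩
        ⟦ s ⟧ᴹ u                                    ∎)
      (λ h → ∙-cancelʳ (-ᴹ (x · r)) _ _ (begin
        z *ᵣ a +ᴹ -ᴹ (x · r)                        ≈⟨ row ⟨
        x̂ · (a Vector.∷ pad N (λ i → r i * - 1#))   ≈⟨ h ⟩
        ⟦ s ⟧ᴹ u                                    ≈⟨ xyx⁻¹≈y _ _ ⟨
        x · r +ᴹ ⟦ s ⟧ᴹ u +ᴹ -ᴹ (x · r)             ≈⟨ +ᴹ-cong (split-⟦⟧ t u x) ≈ᴹ-refl ⟨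
        ⟦ t ⟧ᴹ (u ++ x) +ᴹ -ᴹ (x · r)               ∎))
      where
      z = Vector.head x̂
      r = proj₁ (split n t)
      s = proj₂ (split n t)
      row : x̂ · (a Vector.∷ pad N (λ i → r i * - 1#)) ≈ᴹ z *ᵣ a +ᴹ -ᴹ (x · r)
      row = +ᴹ-cong ≈ᴹ-refl (≈ᴹ-trans (ext _) (≈ᴹ-trans (·-*ʳ x r (- 1#)) (*ᵣ-neg _)))

    conditions⇒rows : (Cs : List (Condition (n ℕ.+ k))) (x : Vector Carrierᴹ k) →
      All (Divisible (u ++ x)) Cs → ∃ λ x̂ → Extends (length Cs) x̂ x × Allⱽ (Holds u x̂) (rows Cs)
    conditions⇒rows [] x [] = x , (λ _ → ≈ᴹ-refl) , []
    conditions⇒rows ((a , t) ∷ Cs) x ((z , za≈t) ∷ hCs) with conditions⇒rows Cs x hCs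
    ... | x̂ , ext , hRs = z Vector.∷ x̂ ,
      (λ r → ≈ᴹ-trans (0∷-· (z Vector.∷ x̂) (pad (length Cs) r)) (ext r)) ,
      Equivalence.to (first-row a t (z Vector.∷ x̂) x ext) za≈t ∷
      Equivalence.to (weaken-holds (z Vector.∷ x̂)) hRs

    rows⇒conditions : (Cs : List (Condition (n ℕ.+ k))) (x̂ : Vector Carrierᴹ (length Cs ℕ.+ k)) →
      Allⱽ (Holds u x̂) (rows Cs) → ∃ λ x → Extends (length Cs) x̂ x × All (Divisible (u ++ x)) Cs
    rows⇒conditions [] x [] = x , (λ _ → ≈ᴹ-refl) , []
    rows⇒conditions ((a , t) ∷ Cs) x̂ (h ∷ hRs)
      with rows⇒conditions Cs (Vector.tail x̂) (Equivalence.from (weaken-holds x̂) hRs)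
    ... | x , ext , hCs = x ,
      (λ r → ≈ᴹ-trans (0∷-· x̂ (pad (length Cs) r)) (ext r)) ,
      (Vector.head x̂ , Equivalence.from (first-row a t x̂ x ext) h) ∷ hCs

  -- Only 0 is a multiple of 0, so an equation is divisibility of the difference by 0. For a
  -- predicate, a is the ring element representing its index in the group of divisibility.
  condition : Atomic Carrier (Γ⁺ B) n → Condition n
  condition (t ≐ᵗ t′)                = 0# , t ⊕ (⊖ t′)
  condition (V[ _ , a , _ , _ ] t) = a , t

  -- One direction is the axiom `V-div`. For the other, z satisfies the predicate of index 1 by
  -- `V-1`, and `V-*` carries this to z a with index v(a).
  ∈V⇔divisible : ∀ {x} ((δ , a , a≉0 , δ≈va) : Γ⁺ B) →
                 x ∈ V (δ , a , a≉0 , δ≈va) ⇔ ∃ λ z → z *ᵣ a ≈ᴹ x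
  ∈V⇔divisible {x} δ⁺@(δ , a , a≉0 , δ≈va@(w , w∣1 , va≈wδ)) = mk⇔
    (V-div a≉0 δ≈va)
    (λ (z , za≈x) → V-respects {δ = δ⁺} {ε = δ⁺} (≈ᵞ-refl δ) za≈x
      (V-* {δ = one} a≉0 (w , w∣1 , Q.trans (Q.*-identityˡ _) va≈wδ)
        (V-1 {δ = one} (≈ᵞ-refl 1ᵞ) z)))
    where
    open Divisibility B using (_≈ᵞ_; 1ᵞ)
    module Q = IntegralDomain (FractionField B)
    ≈ᵞ-refl : ∀ ε → ε ≈ᵞ ε
    ≈ᵞ-refl ε = 1# , (1# , *-identityˡ 1#) , Q.sym (Q.*-identityˡ _)
    one : Γ⁺ B
    one = 1ᵞ , 1# , 1≉0 , ≈ᵞ-refl 1ᵞ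

  condition-holds : (u : Vector Carrierᴹ n) (A : Atomic Carrier (Γ⁺ B) n) →
                    HoldsAtomic (valuedStructure B M) u A ⇔ Divisible u (condition A)
  condition-holds u (t ≐ᵗ t′) = mk⇔
    (λ (lift t≈t′) → 0ᴹ , ≈ᴹ-trans (*ᵣ-zeroʳ _) (≈ᴹ-sym (x≈y⇒x∙y⁻¹≈ε t≈t′)))
    (λ (z , z0≈) → lift (x∙y⁻¹≈ε⇒x≈y _ _ (≈ᴹ-trans (≈ᴹ-sym z0≈) (*ᵣ-zeroʳ z))))
  condition-holds u (V[ δ ] t) = mk⇔
    (λ (lift t∈V) → Equivalence.to (∈V⇔divisible δ) t∈V)
    (λ h → lift (Equivalence.from (∈V⇔divisible δ) h))

  -- The bound variables of φ and the witnesses of its divisibilities together are the unknowns of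
  -- one linear system, to which elimination applies.
  pp⇔conditions : (φ : PPFormula Carrier (Γ⁺ B) n) → ∃ λ (Cs : List (Condition n)) →
                  ∀ u → HoldsPP (valuedStructure B M) φ u ⇔ All (Divisible u) Cs
  pp⇔conditions {n} (∃[ k ] θ) with eliminate (rows (List.map condition θ))
  ... | Cs , solved = Cs , λ u → mk⇔
    (λ (x , hθ) →
      let (x̂ , _ , hRs) = conditions⇒rows u (List.map condition θ) x
                            (All.map⁺ (All.map (Equivalence.to (condition-holds _ _)) hθ))
      in Equivalence.to (solved u) (x̂ , hRs))
    (λ hCs →
      let (x̂ , hRs) = Equivalence.from (solved u) hCs
          (x , _ , hθ) = rows⇒conditions u (List.map condition θ) x̂ hRs
      in x , All.map (Equivalence.from (condition-holds _ _)) (All.map⁻ hθ))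

-- The local-global principle for divisibility.

module LocalGlobal
  (em : ∀ {a} → ExcludedMiddle a)
  (zorn : ∀ {a ℓ₁ ℓ₂ p} → ZornsLemma a ℓ₁ ℓ₂ p)
  (B : IntegralDomain c ℓ)
  (M : ValuedModule B m ℓm ℓv) where

  open IntegralDomain B hiding (zero)
  open ValuedModule M
  open SetoidReasoning ≈ᴹ-setoid
  open Resizing em
  open Conditions B M
  open MaximalIdeals em zorn commutativeRing

  -- Divisibility of x by a in the localization at 𝓜, with denominators cleared.
  LocallyDivisible : MSpec commutativeRing → Carrierᴹ → Carrier → Set _
  LocallyDivisible 𝓜 x a = ∃ λ s → s ∉ MSpec.member 𝓜 × ∃ λ z → z *ᵣ a ≈ᴹ s *ₗ x

  -- If the ideal of all s with a ∣ s x were proper, some maximal 𝓜 would contain it, against the s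
  -- outside 𝓜 that local divisibility supplies.
  locallyDivisible⇒divisible : ∀ x a → (∀ 𝓜 → LocallyDivisible 𝓜 x a) → ∃ λ z → z *ᵣ a ≈ᴹ x
  locallyDivisible⇒divisible x a local = decidable-stable em λ ¬divisible →
    let (𝓜 , I⊆𝓜) = proper⇒⊆maximal I (¬divisible ∘ 1∈⇒divisible)
        (s , s∉𝓜 , h) = local 𝓜
    in s∉𝓜 (I⊆𝓜 (resize h))
    where
    I : Ideal commutativeRing
    I = record
      { member = λ s → Resize _ (∃ λ z → z *ᵣ a ≈ᴹ s *ₗ x)
      ; respects = λ s≈t s∈ → let (z , eq) = unresize s∈ in
          resize (z , ≈ᴹ-trans eq (*ₗ-congʳ s≈t))
      ; 0∈ = resize (0ᴹ , ≈ᴹ-trans (*ᵣ-zeroˡ a) (≈ᴹ-sym (*ₗ-zeroˡ x)))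
      ; +-closed = λ s∈ t∈ → let (z , eq) = unresize s∈ ; (z′ , eq′) = unresize t∈ in
          resize (z +ᴹ z′ , ≈ᴹ-trans (*ᵣ-distribʳ a z z′)
            (≈ᴹ-trans (+ᴹ-cong eq eq′) (≈ᴹ-sym (*ₗ-distribʳ x _ _))))
      ; *-closed = λ r s∈ → let (z , eq) = unresize s∈ in
          resize (r *ₗ z , ≈ᴹ-trans (*ₗ-*ᵣ-assoc r z a)
            (≈ᴹ-trans (*ₗ-congˡ eq) (≈ᴹ-sym (*ₗ-assoc r _ x))))
      }

    1∈⇒divisible : 1# ∈ Ideal.member I → ∃ λ z → z *ᵣ a ≈ᴹ x
    1∈⇒divisible 1∈ = let (z , eq) = unresize 1∈ in z , ≈ᴹ-trans eq (*ₗ-identityˡ x)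

  -- All of MSpec(B), presented as V(0): every maximal ideal contains 0.
  MaxSpec : Pred (MSpec commutativeRing) (c ⊔ ℓ)
  MaxSpec = basicClosed commutativeRing 0#

  -- Conditions as local formulas.

  scalar : Carrier → ScalarsOver B MaxSpec
  scalar a = Localization.embed commutativeRing (nonzeros B) a , λ {𝓜} _ →
    Localization.embed commutativeRing (complement B 𝓜) a ,
    Localization.ℛ.cross commutativeRing (nonzeros B) refl

  value : (a : Carrier) → ¬ a ≈ 0# → ValuesOver B MaxSpec
  value a a≉0 = Divisibility.v B a a≉0 , λ {𝓜} _ →
    let module L = IntegralDomain (LocalDomain B 𝓜)
        module LD = MonoidDivisibility L.*-monoid in
    Localization.embed commutativeRing (complement B 𝓜) a , embed-nonzero B 𝓜 a≉0 ,
    L.1# , LD._,_ L.1# (L.*-identityˡ L.1#) ,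
    -- With the unit 1, the equality of fractions cross-multiplies to (1 · 1) · a = 1 · (1 · a).
    Localization.ℛ.cross L.commutativeRing (nonzeros (LocalDomain B 𝓜))
      (L.*-assoc L.1# L.1# (Localization.embed commutativeRing (complement B 𝓜) a))

  liftTerm : Term Carrier n → Term (ScalarsOver B MaxSpec) n
  liftTerm (var i) = var i
  liftTerm 𝟎       = 𝟎
  liftTerm (t ⊕ r) = liftTerm t ⊕ liftTerm r
  liftTerm (⊖ t)   = ⊖ liftTerm t
  liftTerm (t ⊙ a) = liftTerm t ⊙ scalar a

  -- The value v(a) exists only for nonzero a, so divisibility by 0 has to become an equation.
  conditionAtom : (a : Carrier) → Term Carrier n → Dec (a ≈ 0#) →
                  Atomic (ScalarsOver B MaxSpec) (ValuesOver B MaxSpec) n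
  conditionAtom a t (yes _)  = liftTerm t ≐ᵗ 𝟎
  conditionAtom a t (no a≉0) = V[ value a a≉0 ] (liftTerm t)

  module _ {𝓜 : MSpec commutativeRing} (𝓜∈ : 𝓜 ∈ MaxSpec) where
    open Localization commutativeRing (complement B 𝓜) using (embed; _/_[_])
    open Localization.Additive commutativeRing (complement B 𝓜) baseModule
      using (_≋_; equal; cross; ≋-refl; 𝟘)
    private
      module S = MultiplicativeSet (complement B 𝓜)
      module M𝓜 = Module (LocalModule B 𝓜 baseModule)

    1*-identityˡ : ∀ x → (1# * 1#) *ₗ x ≈ᴹ x
    1*-identityˡ x = ≈ᴹ-trans (*ₗ-congʳ (*-identityˡ 1#)) (*ₗ-identityˡ x)

    embed-cong : ∀ {x y} → x ≈ᴹ y → embed x ≋ embed y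
    embed-cong x≈y = cross (*ₗ-congˡ x≈y)

    -- The den∈S components cannot be inferred from _≋_, hence the explicit fractions.
    ≋-trans : ∀ f g h → f ≋ g → g ≋ h → f ≋ h
    ≋-trans f g h = M𝓜.≈ᴹ-trans {f} {g} {h}

    ≋-sym : ∀ f g → f ≋ g → g ≋ f
    ≋-sym f g = M𝓜.≈ᴹ-sym {f} {g}

    embed-+ : ∀ f g x y → f ≋ embed x → g ≋ embed y → f M𝓜.+ᴹ g ≋ embed (x +ᴹ y)
    embed-+ f g x y f≋x g≋y = ≋-trans (f M𝓜.+ᴹ g) (embed x M𝓜.+ᴹ embed y) (embed (x +ᴹ y))
      (M𝓜.+ᴹ-cong {f} {embed x} {g} {embed y} f≋x g≋y)
      (cross (≈ᴹ-trans (*ₗ-identityˡ _)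
        (≈ᴹ-trans (+ᴹ-cong (*ₗ-identityˡ x) (*ₗ-identityˡ y)) (≈ᴹ-sym (1*-identityˡ _)))))

    embed-* : ∀ f x a → f ≋ embed x → f M𝓜.*ᵣ embed a ≋ embed (x *ᵣ a)
    embed-* f x a f≋x = ≋-trans (f M𝓜.*ᵣ embed a) (embed x M𝓜.*ᵣ embed a) (embed (x *ᵣ a))
      (M𝓜.*ᵣ-congʳ {embed a} {f} {embed x} f≋x)
      (cross (≈ᴹ-trans (*ₗ-identityˡ _)
        (≈ᴹ-trans (*ₗ-*ᵣ-coincident a x) (≈ᴹ-sym (1*-identityˡ _)))))

    -- Some s outside 𝓜 annihilates x, and 0 is a multiple of every a.
    embed≋0⇒locallyDivisible : ∀ {x} a → embed x ≋ 𝟘 → LocallyDivisible 𝓜 x a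
    embed≋0⇒locallyDivisible {x} a (equal s s∉ eq) = s , s∉ , 0ᴹ , (begin
      0ᴹ *ᵣ a         ≈⟨ *ᵣ-zeroˡ a ⟩
      0ᴹ              ≈⟨ ≈ᴹ-trans (*ₗ-congˡ (*ₗ-zeroʳ 1#)) (*ₗ-zeroʳ s) ⟨
      s *ₗ 1# *ₗ 0ᴹ   ≈⟨ eq ⟨
      s *ₗ 1# *ₗ x    ≈⟨ *ₗ-congˡ (*ₗ-identityˡ x) ⟩
      s *ₗ x          ∎)

    embed-divisible⇒locallyDivisible : ∀ {x a} f → f M𝓜.*ᵣ embed a ≋ embed x →
                                       LocallyDivisible 𝓜 x a
    embed-divisible⇒locallyDivisible {x} {a} (y / t [ t∉ ]) (equal s s∉ eq) =
      -- The factor s from the equality of fractions and the denominator t of y / t both go into the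
      -- multiplier of x; the quotient by a is then s y.
      s * (1# * t) , S.*-closed s∉ (S.*-closed S.1∈ t∉) , s *ₗ y , (begin
      (s *ₗ y) *ᵣ a                   ≈⟨ *ₗ-*ᵣ-assoc s y a ⟩
      s *ₗ (y *ᵣ a)                   ≈⟨ *ₗ-congˡ (*ₗ-*ᵣ-coincident a y) ⟨
      s *ₗ a *ₗ y                     ≈⟨ *ₗ-congˡ (*ₗ-identityˡ _) ⟨
      s *ₗ 1# *ₗ a *ₗ y               ≈⟨ eq ⟩
      s *ₗ (1# * t) *ₗ x              ≈⟨ *ₗ-assoc s (1# * t) x ⟨
      (s * (1# * t)) *ₗ x             ∎)


    ⟦_⟧𝓜 : Term (ScalarsOver B MaxSpec) n → Vector M𝓜.Carrierᴹ n → M𝓜.Carrierᴹ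
    ⟦ t ⟧𝓜 = ⟦_⟧ (localStructure B MaxSpec baseModule {𝓜} 𝓜∈) t

    ⟦liftTerm⟧ : (t : Term Carrier n) (u : Vector Carrierᴹ n) →
      ⟦ liftTerm t ⟧𝓜 (localTuple B baseModule 𝓜 u) ≋ embed (⟦ t ⟧ᴹ u)
    ⟦liftTerm⟧ (var i) u = ≋-refl
    ⟦liftTerm⟧ 𝟎       u = ≋-refl
    ⟦liftTerm⟧ (t ⊕ r) u =
      embed-+ (⟦ liftTerm t ⟧𝓜 _) (⟦ liftTerm r ⟧𝓜 _) _ _ (⟦liftTerm⟧ t u) (⟦liftTerm⟧ r u)
    ⟦liftTerm⟧ (⊖ t)   u = M𝓜.-ᴹ‿cong {⟦ liftTerm t ⟧𝓜 _} {embed _} (⟦liftTerm⟧ t u)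
    ⟦liftTerm⟧ (t ⊙ a) u = embed-* (⟦ liftTerm t ⟧𝓜 _) _ a (⟦liftTerm⟧ t u)

    HoldsAt : Vector Carrierᴹ n → Atomic (ScalarsOver B MaxSpec) (ValuesOver B MaxSpec) n → Set _
    HoldsAt u = HoldsAtomic (localStructure B MaxSpec baseModule {𝓜} 𝓜∈)
                            (localTuple B baseModule 𝓜 u)

    divisible⇒holdsAt : (u : Vector Carrierᴹ n) (a : Carrier) (t : Term Carrier n)
      (a≟0 : Dec (a ≈ 0#)) →
      Divisible u (a , t) → HoldsAt u (conditionAtom a t a≟0)
    divisible⇒holdsAt u a t (yes a≈0) (z , za≈t) = lift
      (≋-trans (⟦ liftTerm t ⟧𝓜 _) (embed (⟦ t ⟧ᴹ u)) 𝟘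
      (⟦liftTerm⟧ t u)
      (embed-cong (≈ᴹ-trans (≈ᴹ-sym za≈t) (≈ᴹ-trans (*ᵣ-congˡ a≈0) (*ᵣ-zeroʳ z)))))
    divisible⇒holdsAt u a t (no _) (z , za≈t) = lift (embed z ,
      ≋-trans (embed z M𝓜.*ᵣ embed a) (embed (z *ᵣ a)) (⟦ liftTerm t ⟧𝓜 _)
        (embed-* (embed z) z a ≋-refl)
      (≋-trans (embed (z *ᵣ a)) (embed (⟦ t ⟧ᴹ u)) (⟦ liftTerm t ⟧𝓜 _) (embed-cong za≈t)
        (≋-sym (⟦ liftTerm t ⟧𝓜 _) (embed (⟦ t ⟧ᴹ u)) (⟦liftTerm⟧ t u))))

    holdsAt⇒locallyDivisible : (u : Vector Carrierᴹ n) (a : Carrier) (t : Term Carrier n)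
      (a≟0 : Dec (a ≈ 0#)) →
      HoldsAt u (conditionAtom a t a≟0) → LocallyDivisible 𝓜 (⟦ t ⟧ᴹ u) a
    holdsAt⇒locallyDivisible u a t (yes _) (lift t≈0) = embed≋0⇒locallyDivisible a
      (≋-trans (embed (⟦ t ⟧ᴹ u)) (⟦ liftTerm t ⟧𝓜 _) 𝟘
        (≋-sym (⟦ liftTerm t ⟧𝓜 _) (embed (⟦ t ⟧ᴹ u)) (⟦liftTerm⟧ t u)) t≈0)
    holdsAt⇒locallyDivisible u a t (no _) (lift (f , fa≈t)) = embed-divisible⇒locallyDivisible f
      (≋-trans (f M𝓜.*ᵣ embed a) (⟦ liftTerm t ⟧𝓜 _) (embed (⟦ t ⟧ᴹ u)) fa≈t (⟦liftTerm⟧ t u))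

  conditionConjunction : List (Condition n) →
                         Conjunction (ScalarsOver B MaxSpec) (ValuesOver B MaxSpec) n
  conditionConjunction = List.map λ (a , t) → conditionAtom a t em

  module _ (u : Vector Carrierᴹ n) where

    divisible⇒local : (Cs : List (Condition n)) → All (Divisible u) Cs →
      ∀ {𝓜} (𝓜∈ : 𝓜 ∈ MaxSpec) → All (HoldsAt {𝓜} 𝓜∈ u) (conditionConjunction Cs)
    divisible⇒local [] [] _ = []
    divisible⇒local ((a , t) ∷ Cs) (h ∷ hs) {𝓜} 𝓜∈ =
      divisible⇒holdsAt {𝓜} 𝓜∈ u a t em h ∷ divisible⇒local Cs hs {𝓜} 𝓜∈

    local⇒divisible : (Cs : List (Condition n)) →
      (∀ {𝓜} (𝓜∈ : 𝓜 ∈ MaxSpec) → All (HoldsAt {𝓜} 𝓜∈ u) (conditionConjunction Cs)) →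
      All (Divisible u) Cs
    local⇒divisible [] local = []
    local⇒divisible ((a , t) ∷ Cs) local =
      locallyDivisible⇒divisible (⟦ t ⟧ᴹ u) a (λ 𝓜 →
        holdsAt⇒locallyDivisible {𝓜} (MSpec.0∈ 𝓜) u a t em (All.head (local {𝓜} (MSpec.0∈ 𝓜)))) ∷
      local⇒divisible Cs (λ {𝓜} 𝓜∈ → All.tail (local {𝓜} 𝓜∈))

corollary5p7 : (∀ {a} → ExcludedMiddle a) →
    (∀ {a ℓ₁ ℓ₂ p} → ZornsLemma a ℓ₁ ℓ₂ p) →
    ∀ {c ℓ m ℓm ℓv} (B : IntegralDomain c ℓ) → let open IntegralDomain B in
    IsBézout commutativeRing →
    HasGoodFactorization commutativeRing →
    (M : ValuedModule B m ℓm ℓv) → let open ValuedModule M in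
    {n : ℕ} (φ : PPFormula Carrier (Γ⁺ B) n) →
    Σ ℕ λ k → Σ (Fin k → Pred (MSpec commutativeRing) (c ⊔ ℓ)) λ O →
    IsPartition O ×
    (∀ i → IsBasicOpen commutativeRing (O i) ⊎ IsBasicClosed commutativeRing (O i)) ×
    Σ (∀ i → Conjunction (ScalarsOver B (O i)) (ValuesOver B (O i)) n) λ θ →
    ∀ (u : Vector Carrierᴹ n) →
    HoldsPP (valuedStructure B M) φ u ⇔
    (∀ i {𝓜} (𝓜∈Oᵢ : 𝓜 ∈ O i) →
    HoldsConjunction (localStructure B (O i) baseModule 𝓜∈Oᵢ) (θ i)
    (localTuple B baseModule 𝓜 u))
corollary5p7 em zorn B bézout goodFactorization M φ =
  -- A partition with a single piece, V(0).
  1 , (λ _ → MaxSpec) ,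
  ((λ _ → proj₁ someMaximal , MSpec.0∈ (proj₁ someMaximal)) ,
   λ 𝓜 → zero , MSpec.0∈ 𝓜 , λ { {zero} _ → ≡.refl }) ,
  (λ _ → inj₂ (0# , id , id)) ,
  (λ _ → conditionConjunction Cs) ,
  λ u → mk⇔
    (λ hφ _ {𝓜} 𝓜∈ → divisible⇒local u Cs (Equivalence.to (φ⇔Cs u) hφ) {𝓜} 𝓜∈)
    (λ local → Equivalence.from (φ⇔Cs u) (local⇒divisible u Cs λ {𝓜} → local zero {𝓜}))
  where
  open IntegralDomain B hiding (zero)
  open MonoidDivisibility *-monoid using (_,_)
  open LocalGlobal em zorn B M
  open BézoutDomain em zorn B bézout using (principal)

  Cs = proj₁ (LinearSystems.pp⇔conditions em zorn B bézout goodFactorization M φ)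
  φ⇔Cs = proj₂ (LinearSystems.pp⇔conditions em zorn B bézout goodFactorization M φ)

  -- A piece of a partition must be inhabited. In a domain the zero ideal is proper, so it lies in a
  -- maximal ideal.
  someMaximal : ∃ λ (𝓜 : MSpec commutativeRing) → _
  someMaximal = MaximalIdeals.proper⇒⊆maximal em zorn commutativeRing (principal 0#)
    λ { (q , q0≈1) → 1≉0 (trans (sym q0≈1) (zeroʳ q)) }
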